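{- Let $r\geq 4$ be an integer and let $G$ be a graph containing no subgraph isomorphic to the complete graph $K_r$, with maximum degree $\Delta\geq 3$. Then $\chi_{\ell}(G)\leq 200r \frac{\Delta\ln\ln\Delta}{\ln \Delta}$.
   Context: The list chromatic number $\chi_\ell(G)$ of a graph $G$ is the smallest integer $q$ such that for every assignment of a list of $q$ colours to each vertex of $G$, there is a proper colouring of $G$ in which every vertex receives a colour from its own list. -}

module Defs where

open import Data.Nat using (ℕ; zero; suc; _^_) renaming (_*_ to _*ℕ_; _≤_ to _≤ℕ_)
open import Data.Fin using (Fin)
open import Data.List using (List; length; filter)
open import Data.List.Membership.Propositional using (_∈_)
open import Data.List.Relation.Unary.Unique.Propositional using (Unique)
open import Data.List.Base using (allFin)
open import Data.Integer using (+_)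
open import Data.Rational using (ℚ; 0ℚ; 1ℚ; _+_; _*_; _/_; _≤_)
open import Data.Product using (Σ; _×_; ∃)
open import Relation.Binary.PropositionalEquality using (_≡_; _≢_)
open import Relation.Nullary using (¬_; Dec)
open import Relation.Unary using (Decidable)
open import Function.Definitions using (Injective)
open import Level using (0ℓ)

record Graph : Set₁ where
  field
    n     : ℕ
    Adj   : Fin n → Fin n → Set
    sym   : ∀ {u v} → Adj u v → Adj v u
    irr   : ∀ {v} → ¬ Adj v v
    adj?  : ∀ u v → Dec (Adj u v)

open Graph public

degree : (G : Graph) → Fin (n G) → ℕ
degree G v = length (filter (adj? G v) (allFin (n G)))

MaxDegree : Graph → ℕ → Set
MaxDegree G Δ = (∀ v → degree G v ≤ℕ Δ) × ∃ (λ v → degree G v ≡ Δ)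

ContainsK : Graph → ℕ → Set
ContainsK G r = Σ (Fin r → Fin (n G)) λ f →
  Injective _≡_ _≡_ f × (∀ i j → i ≢ j → Adj G (f i) (f j))

ListAssignment : Graph → ℕ → Set
ListAssignment G q = Σ (Fin (n G) → List ℕ) λ L → ∀ v → Unique (L v) × length (L v) ≡ q

Choosable : Graph → ℕ → Set
Choosable G q = (LA : ListAssignment G q) →
  Σ (Fin (n G) → ℕ) λ c →
    (∀ v → c v ∈ Data.Product.proj₁ LA v) × (∀ u v → Adj G u v → c u ≢ c v)

-- χ_ℓ(G) ≤ q  (χ_ℓ is the least q such that G is q-choosable)
ListChromaticAtMost : Graph → ℕ → Set
ListChromaticAtMost = Choosable

powℚ : ℚ → ℕ → ℚ
powℚ y zero    = 1ℚ
powℚ y (suc k) = powℚ y k * y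

expTerm : ℚ → ℕ → ℚ
expTerm y zero    = 1ℚ
expTerm y (suc k) = expTerm y k * (y * (+ 1 / suc k))

expPartial : ℚ → ℕ → ℚ
expPartial y zero    = 0ℚ
expPartial y (suc m) = expPartial y m + expTerm y m

fromℕℚ : ℕ → ℚ
fromℕℚ a = + a / 1

-- BoundOK M Δ q  ⇔  exp(Δ^(q/M)) ≤ Δ  ⇔  q ≤ M · ln ln Δ / ln Δ   (for Δ ≥ 3, M ≥ 1)
-- Encoded through rationals only: for every rational y ≥ 0 with y^M ≤ Δ^q
-- (i.e. y ≤ Δ^(q/M)), every partial sum of the exponential series at y is ≤ Δ.
BoundOK : ℕ → ℕ → ℕ → Set
BoundOK M Δ q = (y : ℚ) → 0ℚ ≤ y → powℚ y M ≤ fromℕℚ (Δ ^ q) →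
  (m : ℕ) → expPartial y m ≤ fromℕℚ Δ

ListChromaticBound : Graph → ℕ → ℕ → Set
ListChromaticBound G r Δ =
  Σ ℕ λ q → BoundOK (200 *ℕ r *ℕ Δ) Δ q × ListChromaticAtMost G q

{-# OPTIONS --safe #-}

-- Rosenfeld counting. Write C(S) for the set of proper list colourings of the subgraph induced by S.
-- By induction on |S|, |C(S + v)| ≥ ℓ |C(S)| with ℓ about √Δ, that is, a uniform c ∈ C(S) leaves on
-- average at least ℓ colours of the list of v unused on N(v).
--
-- Fix a colour x. In c, recolour every neighbour of v coloured x that has another available colour
-- with the first such colour. The fibre of the resulting colouring c′ consists of the recolourings
-- by x of the independent subsets of a set T(c′) ⊆ N(v). In a K_r-free graph with more than Δ^(1/4)
-- independent sets their average size is of order ln Δ / (r ln ln Δ), which cannot happen in most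
-- fibres for most x, since the colour classes partition the at most Δ vertices of N(v). Hence x is
-- removed entirely with probability about Δ^(-1/4) for most of the colours x. The neighbours u that
-- could not be recoloured have a single available colour; by the induction hypothesis for S - u this
-- has probability at most 1/ℓ, so they cost at most Δ/ℓ colours on average.
module Submission where

open import Defs hiding (sym)
open import Data.Bool using (Bool; true; false; if_then_else_)
open import Data.Bool.Properties using () renaming (_≟_ to _≟ᵇ_)
open import Data.Empty using (⊥-elim; ⊥)
import Data.Fin as Fin
open import Data.Fin using (Fin; zero; suc)
open import Data.Fin.Properties using (all?; any?)
import Data.Integer as ℤ
import Data.Integer.Properties as ℤ
import Data.List as List
open import Data.List
  using (List; []; _∷_; _++_; map; concatMap; length; filter; head; allFin; cartesianProductWith)
import Data.List.Membership.DecPropositional as DecMembership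
open import Data.List.Membership.Propositional using (_∈_; _∉_; find; lose)
open import Data.List.Membership.Propositional.Properties
  using (∈-∃++; ∈-++⁺ˡ; ∈-++⁺ʳ; ∈-++⁻; ∈-filter⁻; ∈-concatMap⁻; ∈-filter⁺; ∈-map⁺; ∈-map⁻;
         ∈-allFin; ∈-cartesianProductWith⁺; ∈-cartesianProductWith⁻; ∈-concatMap⁺; ∈-lookup)
open import Data.List.Properties
  using (length-++; filter-accept; filter-reject; length-map; filter-++; map-cong-local)
open import Data.List.Relation.Binary.Sublist.Propositional
  using (_⊆_; []; _∷_; _∷ʳ_; lookup; ⊆-trans; minimum)
open import Data.List.Relation.Binary.Sublist.Propositional.Properties using (filter-⊆)
import Data.List.Relation.Unary.All as All
open import Data.List.Relation.Unary.All using (All; []; _∷_)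
open import Data.List.Relation.Unary.AllPairs using (AllPairs; []; _∷_)
import Data.List.Relation.Unary.Any as Any
open import Data.List.Relation.Unary.Any using (here; there)
open import Data.List.Relation.Unary.Unique.Propositional using (Unique)
import Data.List.Relation.Unary.Unique.Propositional.Properties as Unique
open import Data.Maybe using (Maybe; just; nothing; fromMaybe)
open import Data.Maybe.Properties using (just-injective) renaming (≡-dec to maybe-≡-dec)
import Data.Nat as ℕ
open import Data.Nat
  using (ℕ; zero; suc; _≤_; _+_; _*_; z≤n; s≤s; _<_; _^_; _≤?_; ≤-pred; NonZero; _∸_; _/_)
open import Data.Nat.DivMod using (m/n*n≤m; m≡m%n+[m/n]*n; m%n<n)
import Data.Nat.Properties as ℕ
open import Data.Nat.Properties
  using (≤-refl; ≤-trans; ≤-reflexive; n≤1+n; m≤n+m; +-mono-≤; +-monoʳ-≤; +-suc; +-identityʳ;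
         *-identityʳ; *-zeroʳ; module ≤-Reasoning; <⇒≤; <-≤-trans; ≤-<-trans; <⇒≱; ≰⇒>; m≤m+n;
         +-monoˡ-≤; +-cancelʳ-≤; *-mono-≤; *-monoʳ-≤; *-monoˡ-≤; ^-monoˡ-≤; ^-monoʳ-≤; ^-monoʳ-<;
         ^-*-assoc; m≤n*m; m^n>0; *-cancelˡ-≤; *-comm; *-assoc; n<1+n; +-cancelˡ-≤; m^n≢0;
         ^-distribˡ-+-*; *-distribʳ-+; *-cancelʳ-<; m≤m*n; m<m+n; m*n≢0; +-comm; *-cancelʳ-≤;
         +-monoˡ-<; *-cancelˡ-<; ^-zeroˡ; m∸n+n≡m; m+[n∸m]≡n)
open import Data.Nat.Tactic.RingSolver using (solve-∀)
open import Data.Product using (_×_; _,_; proj₁; proj₂; ∃)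
import Data.Rational as ℚ
open import Data.Rational using (ℚ; 0ℚ; 1ℚ)
import Data.Rational.Properties as ℚ
open import Data.Rational.Solver using (module +-*-Solver)
import Data.Rational.Unnormalised as ℚᵘ
import Data.Rational.Unnormalised.Properties as ℚᵘ
open import Data.Sum using (inj₁; inj₂)
open import Data.Vec
  using (Vec; []; _∷_; tabulate; _[_]≔_; replicate)
  renaming (lookup to infixl 20 _at_)
open import Data.Vec.Properties
  using (lookup∘tabulate; tabulate∘lookup; tabulate-cong; []≔-lookup; []≔-idempotent;
         lookup∘update; lookup∘update′; lookup-replicate)
open import Level using (0ℓ)
open import Relation.Binary.PropositionalEquality
  using (_≡_; _≢_; refl; sym; trans; cong; cong₂; subst; subst₂)
open import Relation.Nullary using (¬_; Dec; yes; no; ¬?; does)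
open import Relation.Nullary.Decidable using (_×-dec_; _→-dec_; toWitness)
open import Relation.Unary using (Pred; Decidable)

-- Why order Δ / K colours suffice, where K is the average size in a large fibre and M the threshold
-- on the number of independent sets: take all q N pairs of a colour x and one of the N colourings.
-- A fibre with more than M members has at least K recoloured neighbours per member on average. One
-- colouring recolours at most Δ neighbours over all x, so such fibres hold at most Δ N / K pairs,
-- at most half of all if q K ≥ 2 Δ. The other fibres have at most M members, exactly one of them
-- clear of recolourable neighbours, so at least q N / (2 M) pairs are clear. The induction closes
-- if q / (2 M) - Δ / ℓ ≥ ℓ, and ℓ near √Δ balances the last two terms. Fibres have this simple form
-- because a vertex coloured x has no neighbour coloured x: recolouring the whole class changes
-- nothing around any of its members, so any part of it can be undone independently. The greedy
-- bound Δ + 1 covers small Δ and large r. Where the claimed bound is below it, log Δ exceeds a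
-- large multiple of r log log Δ, and this is the slack for all rounding to integers.

private
  variable
    A B : Set

-- Finite sums and counting in duplicate-free lists

∑ : List A → (A → ℕ) → ℕ
∑ []       f = 0
∑ (x ∷ xs) f = f x + ∑ xs f

# : {P : Pred A 0ℓ} → Decidable P → List A → ℕ
# P? xs = length (filter P? xs)

∑-mono : ∀ (xs : List A) {f g : A → ℕ} → (∀ {x} → x ∈ xs → f x ≤ g x) → ∑ xs f ≤ ∑ xs g
∑-mono []       h = z≤n
∑-mono (x ∷ xs) h = +-mono-≤ (h (here refl)) (∑-mono xs (λ p → h (there p)))

∑-cong : ∀ (xs : List A) {f g : A → ℕ} → (∀ x → f x ≡ g x) → ∑ xs f ≡ ∑ xs g
∑-cong []       h = refl
∑-cong (x ∷ xs) h = cong₂ _+_ (h x) (∑-cong xs h)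

∑-distrib-+ : ∀ (xs : List A) (f g : A → ℕ) → ∑ xs (λ x → f x + g x) ≡ ∑ xs f + ∑ xs g
∑-distrib-+ []       f g = refl
∑-distrib-+ (x ∷ xs) f g rewrite ∑-distrib-+ xs f g = eq (f x) (g x) (∑ xs f) (∑ xs g)
  where
  eq : ∀ a b c d → a + b + (c + d) ≡ a + c + (b + d)
  eq = solve-∀

∑-distribˡ-* : ∀ k (xs : List A) (f : A → ℕ) → ∑ xs (λ x → k * f x) ≡ k * ∑ xs f
∑-distribˡ-* k []       f = eq k
  where
  eq : ∀ k → 0 ≡ k * 0
  eq = solve-∀
∑-distribˡ-* k (x ∷ xs) f rewrite ∑-distribˡ-* k xs f = eq k (f x) (∑ xs f)
  where
  eq : ∀ k a b → k * a + k * b ≡ k * (a + b)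
  eq = solve-∀

∑-const : ∀ (xs : List A) k → ∑ xs (λ _ → k) ≡ length xs * k
∑-const []       k = refl
∑-const (x ∷ xs) k = cong (k +_) (∑-const xs k)

∑-++ : ∀ (xs ys : List A) (f : A → ℕ) → ∑ (xs ++ ys) f ≡ ∑ xs f + ∑ ys f
∑-++ []       ys f = refl
∑-++ (x ∷ xs) ys f rewrite ∑-++ xs ys f = eq (f x) (∑ xs f) (∑ ys f)
  where
  eq : ∀ a b c → a + (b + c) ≡ a + b + c
  eq = solve-∀

∑-map : ∀ (g : B → A) (xs : List B) (f : A → ℕ) → ∑ (map g xs) f ≡ ∑ xs (λ x → f (g x))
∑-map g []       f = refl
∑-map g (x ∷ xs) f = cong (f (g x) +_) (∑-map g xs f)

∑-concatMap : ∀ (g : B → List A) (xs : List B) (f : A → ℕ) → ∑ (concatMap g xs) f ≡ ∑ xs (λ x → ∑ (g x) f)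
∑-concatMap g []       f = refl
∑-concatMap g (x ∷ xs) f = trans (∑-++ (g x) _ f) (cong (∑ (g x) f +_) (∑-concatMap g xs f))

length-∑ : ∀ (xs : List A) → length xs ≡ ∑ xs (λ _ → 1)
length-∑ xs = sym (trans (∑-const xs 1) (*-identityʳ _))

length-concatMap : ∀ (g : B → List A) (xs : List B) → length (concatMap g xs) ≡ ∑ xs (λ x → length (g x))
length-concatMap g []       = refl
length-concatMap g (x ∷ xs) = trans (length-++ (g x)) (cong (length (g x) +_) (length-concatMap g xs))

-- Each element of `zs` is struck out of `ys` in turn; distinctness keeps the remaining ones in what
-- is left. All comparisons between sets of colourings are made through this.
∑-⊆ : ∀ {zs ys : List A} (f : A → ℕ) → Unique zs → (∀ {z} → z ∈ zs → z ∈ ys) → ∑ zs f ≤ ∑ ys f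
∑-⊆ {zs = []} f u h = z≤n
∑-⊆ {zs = z ∷ zs} f (z∉ ∷ u) h with ∈-∃++ (h (here refl))
... | as , bs , refl = begin
  f z + ∑ zs f             ≤⟨ +-monoʳ-≤ (f z) (∑-⊆ f u h′) ⟩
  f z + ∑ (as ++ bs) f     ≡⟨ cong (f z +_) (∑-++ as bs f) ⟩
  f z + (∑ as f + ∑ bs f)  ≡⟨ eq (f z) (∑ as f) (∑ bs f) ⟩
  ∑ as f + (f z + ∑ bs f)  ≡⟨ sym (∑-++ as (z ∷ bs) f) ⟩
  ∑ (as ++ z ∷ bs) f       ∎
  where
  open ≤-Reasoning
  eq : ∀ a b c → a + (b + c) ≡ b + (a + c)
  eq = solve-∀
  h′ : ∀ {w} → w ∈ zs → w ∈ as ++ bs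
  h′ w∈ with ∈-++⁻ as (h (there w∈))
  ... | inj₁ w∈as = ∈-++⁺ˡ w∈as
  ... | inj₂ (here refl) = ⊥-elim (All.lookup z∉ w∈ refl)
  ... | inj₂ (there w∈bs) = ∈-++⁺ʳ as w∈bs

length-⊆ : ∀ {zs ys : List A} → Unique zs → (∀ {z} → z ∈ zs → z ∈ ys) → length zs ≤ length ys
length-⊆ {zs = zs} {ys} u h = begin
  length zs       ≡⟨ length-∑ zs ⟩
  ∑ zs (λ _ → 1)  ≤⟨ ∑-⊆ (λ _ → 1) u h ⟩
  ∑ ys (λ _ → 1)  ≡⟨ sym (length-∑ ys) ⟩
  length ys       ∎
  where open ≤-Reasoning

-- `map g` turns the image back into `xs`, so a repetition in the image would be one in `xs`. The
-- inverse is required on `xs` only, since recolouring and erasing can be undone only on the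
-- colourings concerned.
unique-map : ∀ {f : A → B} (g : B → A) {xs : List A} → (∀ {x} → x ∈ xs → g (f x) ≡ x) →
  Unique xs → Unique (map f xs)
unique-map {f = f} g {xs} inv u = Unique.map⁻ (subst Unique (sym (eq xs inv)) u)
  where
  eq : ∀ xs → (∀ {x} → x ∈ xs → g (f x) ≡ x) → map g (map f xs) ≡ xs
  eq []       inv = refl
  eq (x ∷ xs) inv = cong₂ _∷_ (inv (here refl)) (eq xs (λ p → inv (there p)))

#-∷ : ∀ {P : Pred A 0ℓ} (P? : Decidable P) x xs → # P? (x ∷ xs) ≡ # P? (x ∷ []) + # P? xs
#-∷ P? x xs with P? x
... | yes _ = refl
... | no  _ = refl

∑-#-swap : {R : A → B → Set} (R? : ∀ x y → Dec (R x y)) (xs : List A) (ys : List B) →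
  ∑ xs (λ x → # (R? x) ys) ≡ ∑ ys (λ y → # (λ x → R? x y) xs)
∑-#-swap R? []       ys = sym (trans (∑-const ys 0) (eq (length ys)))
  where
  eq : ∀ k → k * 0 ≡ 0
  eq = solve-∀
∑-#-swap R? (x ∷ xs) ys = trans (cong₂ _+_ (single ys) (∑-#-swap R? xs ys))
  (trans (sym (∑-distrib-+ ys _ _)) (∑-cong ys (λ y → sym (#-∷ (λ x → R? x y) x xs))))
  where
  single : ∀ ys → # (R? x) ys ≡ ∑ ys (λ y → # (λ x → R? x y) (x ∷ []))
  single [] = refl
  single (y ∷ ys) with R? x y
  ... | yes _ = cong suc (single ys)
  ... | no  _ = single ys

#-≤1 : {P : Pred A 0ℓ} (P? : Decidable P) {xs : List A} → Unique xs → (∀ {x y} → P x → P y → x ≡ y) → # P? xs ≤ 1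
#-≤1 P? {xs} u h with filter P? xs in eq
... | [] = z≤n
... | x ∷ zs = length-⊆ {ys = x ∷ []} (subst Unique eq (Unique.filter⁺ P? u)) λ p → here (h (sat p) (sat (here refl)))
  where
  sat : ∀ {z} → z ∈ x ∷ zs → _
  sat p = proj₂ (∈-filter⁻ P? {xs = xs} (subst (_ ∈_) (sym eq) p))

#-map : {P : Pred A 0ℓ} {Q : Pred B 0ℓ} (P? : Decidable P) (Q? : Decidable Q) (f : B → A) →
  (∀ x → P (f x) → Q x) → ∀ xs → # P? (map f xs) ≤ # Q? xs
#-map P? Q? f h [] = z≤n
#-map P? Q? f h (x ∷ xs) with P? (f x) | Q? x
... | yes _ | yes _ = s≤s (#-map P? Q? f h xs)
... | yes p | no  q = ⊥-elim (q (h x p))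
... | no  _ | yes _ = ≤-trans (#-map P? Q? f h xs) (n≤1+n _)
... | no  _ | no  _ = #-map P? Q? f h xs

#-filter : {P Q : Pred A 0ℓ} (P? : Decidable P) (Q? : Decidable Q) → ∀ xs → # P? (filter Q? xs) ≤ # P? xs
#-filter P? Q? [] = z≤n
#-filter P? Q? (x ∷ xs) with Q? x
... | no _ = ≤-trans (#-filter P? Q? xs) (≤-trans (m≤n+m _ _) (≤-reflexive (sym (#-∷ P? x xs))))
... | yes _ = begin
  # P? (x ∷ filter Q? xs)              ≡⟨ #-∷ P? x _ ⟩
  # P? (x ∷ []) + # P? (filter Q? xs)  ≤⟨ +-monoʳ-≤ (# P? (x ∷ [])) (#-filter P? Q? xs) ⟩
  # P? (x ∷ []) + # P? xs              ≡⟨ sym (#-∷ P? x xs) ⟩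
  # P? (x ∷ xs)                        ∎
  where open ≤-Reasoning

#-none : {P : Pred A 0ℓ} (P? : Decidable P) → ∀ xs → (∀ {x} → x ∈ xs → ¬ P x) → # P? xs ≡ 0
#-none P? [] h = refl
#-none P? (x ∷ xs) h = trans (cong length (filter-reject P? {xs = xs} (h (here refl)))) (#-none P? xs (λ p → h (there p)))

∑-swap : ∀ (xs : List A) (ys : List B) (f : A → B → ℕ) → ∑ xs (λ x → ∑ ys (f x)) ≡ ∑ ys (λ y → ∑ xs (λ x → f x y))
∑-swap []       ys f = sym (trans (∑-const ys 0) (*-zeroʳ (length ys)))
∑-swap (x ∷ xs) ys f = trans (cong (∑ ys (f x) +_) (∑-swap xs ys f)) (sym (∑-distrib-+ ys _ _))

-- Blocks are disjoint because `h` reads off from an element the block it lies in.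
unique-concatMap : ∀ (g : B → List A) (h : A → B) {xs : List B} → (∀ {b} → b ∈ xs → Unique (g b)) →
  (∀ {b a} → b ∈ xs → a ∈ g b → h a ≡ b) → Unique xs → Unique (concatMap g xs)
unique-concatMap g h {[]}     ug inv u        = []
unique-concatMap g h {x ∷ xs} ug inv (x∉ ∷ u) =
  Unique.++⁺ (ug (here refl)) (unique-concatMap g h (λ p → ug (there p)) (λ p → inv (there p)) u) disjoint
  where
  disjoint : ∀ {a} → ¬ (a ∈ g x × a ∈ concatMap g xs)
  disjoint (p , q) with find (∈-concatMap⁻ g {xs = xs} q)
  ... | b , b∈ , a∈ = All.lookup x∉ b∈ (trans (sym (inv (here refl) p)) (inv (there b∈) a∈))

null? : ∀ (xs : List A) → Dec (xs ≡ [])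
null? []       = yes refl
null? (_ ∷ _) = no λ ()

-- A sublist inherits the order of `T`, so a set of vertices is represented by one list only. This
-- lets the set switched by `insert` be recovered as an equality of lists.
filter-sublist : {P : Pred A 0ℓ} (P? : Decidable P) {I T : List A} → I ⊆ T → Unique T →
  (∀ {u} → u ∈ I → P u) → (∀ {u} → u ∈ T → P u → u ∈ I) → filter P? T ≡ I
filter-sublist P? []         _        _ _ = refl
filter-sublist P? (y ∷ʳ I⊆T) (y∉ ∷ u) f g = trans
  (filter-reject P? (λ Py → All.lookup y∉ (lookup I⊆T (g (here refl) Py)) refl))
  (filter-sublist P? I⊆T u f (λ p → g (there p)))
filter-sublist P? {y ∷ I} (refl ∷ I⊆T) (y∉ ∷ u) f g = trans
  (filter-accept P? (f (here refl)))
  (cong (y ∷_) (filter-sublist P? I⊆T u (λ p → f (there p)) g′))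
  where
  g′ : ∀ {z} → z ∈ _ → _ → z ∈ I
  g′ p Pz with g (there p) Pz
  ... | here refl = ⊥-elim (All.lookup y∉ p refl)
  ... | there q   = q

allPairs-membership : {R : A → A → Set} (xs : List A) →
  (∀ {x y} → x ∈ xs → y ∈ xs → R x y) → AllPairs R xs
allPairs-membership []       h = []
allPairs-membership (_ ∷ xs) h =
  All.tabulate (λ p → h (here refl) (there p)) ∷ allPairs-membership xs (λ p q → h (there p) (there q))

allPairs-lookup : {R : A → A → Set} → (∀ {x} → R x x) → (∀ {x y} → R x y → R y x) →
  ∀ {xs} → AllPairs R xs → ∀ {x y} → x ∈ xs → y ∈ xs → R x y
allPairs-lookup r s (a ∷ h) (here refl) (here refl) = r
allPairs-lookup r s (a ∷ h) (here refl) (there q)   = All.lookup a q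
allPairs-lookup r s (a ∷ h) (there p)   (here refl) = s (All.lookup a p)
allPairs-lookup r s (a ∷ h) (there p)   (there q)   = allPairs-lookup r s h p q

filter-⊆-filter : {P Q : Pred A 0ℓ} (P? : Decidable P) (Q? : Decidable Q) → ∀ xs →
  (∀ {u} → u ∈ xs → P u → Q u) → filter P? xs ⊆ filter Q? xs
filter-⊆-filter P? Q? []       h = []
filter-⊆-filter P? Q? (x ∷ xs) h with P? x | Q? x
... | yes _ | yes _ = refl ∷ filter-⊆-filter P? Q? xs (λ p → h (there p))
... | yes p | no ¬q = ⊥-elim (¬q (h (here refl) p))
... | no  _ | yes _ = x ∷ʳ filter-⊆-filter P? Q? xs (λ p → h (there p))
... | no  _ | no  _ = filter-⊆-filter P? Q? xs (λ p → h (there p))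

log₂-bounds : ∀ {m} → 1 ≤ m → ∃ λ j → 2 ^ j ≤ m × m < 2 ^ suc j
log₂-bounds {suc zero}    _ = 0 , s≤s z≤n , s≤s (s≤s z≤n)
log₂-bounds {suc (suc m)} _ with log₂-bounds {suc m} (s≤s z≤n)
... | j , lo , hi with 2 ^ suc j ≤? suc (suc m)
...   | no  ≰ = j , ≤-trans lo (n≤1+n _) , ≰⇒> ≰
...   | yes ≤ = suc j , ≤ , ≤-<-trans hi (^-monoʳ-< 2 ≤-refl {suc j} ≤-refl)

-- Independent sets in clique-free graphs

module IndependentSets {V : Set} {Adj : V → V → Set} (adj? : ∀ u v → Dec (Adj u v)) where

  NonAdj : V → V → Set
  NonAdj u v = ¬ Adj u v

  nonAdj? : ∀ u v → Dec (NonAdj u v)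
  nonAdj? u v = ¬? (adj? u v)

  avoids? : ∀ v I → Dec (All (NonAdj v) I)
  avoids? v = All.all? (nonAdj? v)

  indeps : List V → List (List V)
  indeps []       = [] ∷ []
  indeps (v ∷ vs) = indeps vs ++ map (v ∷_) (filter (avoids? v) (indeps vs))

  ∈-indeps⁺ : ∀ {I T} → I ⊆ T → AllPairs NonAdj I → I ∈ indeps T
  ∈-indeps⁺ []             []       = here refl
  ∈-indeps⁺ (y ∷ʳ I⊆T)     h        = ∈-++⁺ˡ (∈-indeps⁺ I⊆T h)
  ∈-indeps⁺ {T = v ∷ vs} (refl ∷ I⊆T) (a ∷ h) =
    ∈-++⁺ʳ (indeps vs) (∈-map⁺ (v ∷_) (∈-filter⁺ (avoids? v) (∈-indeps⁺ I⊆T h) a))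

  ∈-indeps⁻ : ∀ T {I} → I ∈ indeps T → I ⊆ T × AllPairs NonAdj I
  ∈-indeps⁻ []       (here refl) = [] , []
  ∈-indeps⁻ (v ∷ vs) I∈ with ∈-++⁻ (indeps vs) I∈
  ... | inj₁ p = let (s , h) = ∈-indeps⁻ vs p in v ∷ʳ s , h
  ... | inj₂ p with ∈-map⁻ (v ∷_) p
  ...   | J , J∈ , refl with ∈-filter⁻ (avoids? v) {xs = indeps vs} J∈
  ...     | J∈′ , a = let (s , h) = ∈-indeps⁻ vs J∈′ in refl ∷ s , a ∷ h

  indeps-unique : ∀ {T} → Unique T → Unique (indeps T)
  indeps-unique {[]}     _        = [] ∷ []
  indeps-unique {v ∷ vs} (v∉ ∷ u) =
    Unique.++⁺ (indeps-unique u)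
      (Unique.map⁺ (λ { refl → refl }) (Unique.filter⁺ (avoids? v) (indeps-unique u)))
      disj
    where
    disj : ∀ {I} → I ∈ indeps vs × I ∈ map (v ∷_) (filter (avoids? v) (indeps vs)) → ⊥
    disj (p , q) with ∈-map⁻ (v ∷_) q
    ... | J , _ , refl = All.lookup v∉ (lookup (proj₁ (∈-indeps⁻ vs p)) (here refl)) refl

  indeps-mono : ∀ {S T} → Unique S → S ⊆ T → length (indeps S) ≤ length (indeps T)
  indeps-mono {S} u s = length-⊆ (indeps-unique u) λ p →
    let (s′ , h) = ∈-indeps⁻ S p in ∈-indeps⁺ (⊆-trans s′ s) h

  -- The second summand stands for the sets containing `v`: adjoin `v` to an independent set of its
  -- non-neighbours.
  indeps-∷ : ∀ {v vs} → Unique vs →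
    length (indeps vs) + length (indeps (filter (nonAdj? v) vs)) ≤ length (indeps (v ∷ vs))
  indeps-∷ {v} {vs} u = begin
    length (indeps vs) + length (indeps (filter (nonAdj? v) vs))
      ≤⟨ +-monoʳ-≤ (length (indeps vs)) (length-⊆ (indeps-unique (Unique.filter⁺ (nonAdj? v) u)) sub) ⟩
    length (indeps vs) + length (filter (avoids? v) (indeps vs))
      ≡⟨ cong (length (indeps vs) +_) (sym (length-map (v ∷_) (filter (avoids? v) (indeps vs)))) ⟩
    length (indeps vs) + length (map (v ∷_) (filter (avoids? v) (indeps vs)))
      ≡⟨ sym (length-++ (indeps vs)) ⟩
    length (indeps (v ∷ vs)) ∎
    where
    open ≤-Reasoning
    sub : ∀ {I} → I ∈ indeps (filter (nonAdj? v) vs) → I ∈ filter (avoids? v) (indeps vs)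
    sub p = let (s , h) = ∈-indeps⁻ (filter (nonAdj? v) vs) p in
      ∈-filter⁺ (avoids? v) (∈-indeps⁺ (⊆-trans s (filter-⊆ (nonAdj? v) vs)) h)
        (All.tabulate λ q → proj₂ (∈-filter⁻ (nonAdj? v) {xs = vs} (lookup s q)))

  small? : ∀ s (I : List V) → Dec (length I ≤ s)
  small? s I = length I ≤? s

  -- A set containing the head has at most s - 1 further elements (for s = 0 there is none, hence
  -- `lower zero`), and (m + 1)^s + (m + 1)^(s - 1) ≤ (m + 2)^s.
  count-small : ∀ s T → # (small? s) (indeps T) ≤ suc (length T) ^ s
  count-small s [] = subst (1 ≤_) (sym (1^ s)) ≤-refl
    where
    1^ : ∀ s → 1 ^ s ≡ 1
    1^ zero    = refl
    1^ (suc s) = trans (+-identityʳ _) (1^ s)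
  count-small s (v ∷ vs) = begin
    # (small? s) (indeps vs ++ map (v ∷_) J)
      ≡⟨ cong length (filter-++ (small? s) (indeps vs) _) ⟩
    length (filter (small? s) (indeps vs) ++ filter (small? s) (map (v ∷_) J))
      ≡⟨ length-++ (filter (small? s) (indeps vs)) ⟩
    # (small? s) (indeps vs) + # (small? s) (map (v ∷_) J)
      ≤⟨ +-mono-≤ (count-small s vs) (tails s) ⟩
    suc (length vs) ^ s + lower s
      ≤⟨ pascal s ⟩
    suc (suc (length vs)) ^ s ∎
    where
    open ≤-Reasoning
    m = length vs
    J = filter (avoids? v) (indeps vs)
    lower : ℕ → ℕ
    lower zero    = 0
    lower (suc s) = suc m ^ s
    tails : ∀ s → # (small? s) (map (v ∷_) J) ≤ lower s
    tails zero    = ≤-reflexive (#-none (small? 0) (map (v ∷_) J) nonempty)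
      where
      nonempty : ∀ {I} → I ∈ map (v ∷_) J → ¬ length I ≤ 0
      nonempty p q with ∈-map⁻ (v ∷_) p
      nonempty p () | _ , _ , refl
    tails (suc s) = ≤-trans (#-map (small? (suc s)) (small? s) (v ∷_) (λ _ → ≤-pred) J)
      (≤-trans (#-filter (small? s) (avoids? v) (indeps vs)) (count-small s vs))
    pascal : ∀ s → suc m ^ s + lower s ≤ suc (suc m) ^ s
    pascal zero    = ≤-refl
    pascal (suc s) = begin
      suc m * suc m ^ s + suc m ^ s  ≡⟨ eq m (suc m ^ s) ⟩
      suc (suc m) * suc m ^ s        ≤⟨ *-monoʳ-≤ (suc (suc m)) (^-monoˡ-≤ s (n≤1+n (suc m))) ⟩
      suc (suc m) * suc (suc m) ^ s  ∎
      where
      eq : ∀ m x → suc m * x + x ≡ suc (suc m) * x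
      eq = solve-∀

  CliqueFree : ℕ → List V → Set
  CliqueFree r T = ∀ l → length l ≡ r → AllPairs Adj l → All (_∈ T) l → ⊥

  length-partition : ∀ v vs → length (filter (adj? v) vs) + length (filter (nonAdj? v) vs) ≡ length vs
  length-partition v [] = refl
  length-partition v (w ∷ ws) with adj? v w
  ... | yes _ = cong suc (length-partition v ws)
  ... | no  _ = trans (+-suc _ _) (cong suc (length-partition v ws))

  -- Double induction around one vertex `v`. If its neighbourhood is large, pass to it, where the
  -- clique number drops. Otherwise many non-neighbours remain, and each independent set among them
  -- occurs with and without `v`, which doubles the count.
  ramsey : ∀ r j {T} → Unique T → CliqueFree (suc r) T → j ^ r ≤ length T → 2 ^ j ≤ length (indeps T)
  ramsey r zero {T} u cf h = length-⊆ {zs = [] ∷ []} ([] ∷ []) λ { (here refl) → ∈-indeps⁺ (minimum T) [] }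
  ramsey zero (suc j) {[]} u cf ()
  ramsey zero (suc j) {v ∷ vs} u cf h = ⊥-elim (cf (v ∷ []) refl ([] ∷ []) (here refl ∷ []))
  ramsey (suc r) (suc j) {[]} u cf h = ⊥-elim (<⇒≱ (m^n>0 (suc j) (suc r)) h)
  ramsey (suc r) (suc j) {v ∷ vs} (v∉ ∷ u) cf h with suc j ^ r ≤? length (filter (adj? v) vs)
  ... | yes big = ≤-trans (ramsey r (suc j) (Unique.filter⁺ (adj? v) u) cf′ big)
                    (indeps-mono (Unique.filter⁺ (adj? v) u) (v ∷ʳ filter-⊆ (adj? v) vs))
    where
    cf′ : CliqueFree (suc r) (filter (adj? v) vs)
    cf′ l len cl mem = cf (v ∷ l) (cong suc len)
      (All.map (λ p → proj₂ (∈-filter⁻ (adj? v) {xs = vs} p)) mem ∷ cl)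
      (here refl ∷ All.map (λ p → there (proj₁ (∈-filter⁻ (adj? v) {xs = vs} p))) mem)
  ... | no small = begin
    2 ^ suc j                                 ≡⟨ cong (2 ^ j +_) (+-identityʳ (2 ^ j)) ⟩
    2 ^ j + 2 ^ j                             ≤⟨ +-mono-≤ (≤-trans ih (indeps-mono far-unique (filter-⊆ (nonAdj? v) vs))) ih ⟩
    length (indeps vs) + length (indeps far)  ≤⟨ indeps-∷ u ⟩
    length (indeps (v ∷ vs))                  ∎
    where
    open ≤-Reasoning
    near = filter (adj? v) vs
    far = filter (nonAdj? v) vs
    far-unique : Unique far
    far-unique = Unique.filter⁺ (nonAdj? v) u
    -- Of (j + 1)^(r + 1) = j (j + 1)^r + (j + 1)^r vertices, the last summand pays for `v` and its
    -- fewer than (j + 1)^r neighbours.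
    size : j ^ suc r ≤ length far
    size = +-cancelʳ-≤ (suc (length near)) (j ^ suc r) (length far) (begin
      j ^ suc r + suc (length near)   ≤⟨ +-mono-≤ (*-monoʳ-≤ j (^-monoˡ-≤ r (n≤1+n j))) (≰⇒> small) ⟩
      j * suc j ^ r + suc j ^ r       ≡⟨ eq j (suc j ^ r) ⟩
      suc j ^ suc r                   ≤⟨ h ⟩
      suc (length vs)                 ≡⟨ cong suc (sym (length-partition v vs)) ⟩
      suc (length near + length far)  ≡⟨ eq₂ (length near) (length far) ⟩
      length far + suc (length near)  ∎)
      where
      eq : ∀ j x → j * x + x ≡ suc j * x
      eq = solve-∀
      eq₂ : ∀ a b → suc (a + b) ≡ b + suc a
      eq₂ = solve-∀
    cf′ : CliqueFree (suc (suc r)) far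
    cf′ l len cl mem = cf l len cl (All.map (λ p → there (proj₁ (∈-filter⁻ (nonAdj? v) {xs = vs} p))) mem)
    ih : 2 ^ j ≤ length (indeps far)
    ih = ramsey (suc r) j far-unique cf′ size

  -- Every set either has more than `k` elements or is compensated by `k` in the correction term.
  large-total : ∀ k (Is : List (List V)) → k * length Is ≤ ∑ Is length + k * # (small? k) Is
  large-total k [] = ≤-refl
  large-total k (I ∷ Is) rewrite #-∷ (small? k) I Is = begin
    k * suc (length Is)                                     ≡⟨ eq k (length Is) ⟩
    k + k * length Is                                       ≤⟨ +-mono-≤ one (large-total k Is) ⟩
    length I + k * c + (∑ Is length + k * # (small? k) Is)  ≡⟨ eq₂ k (length I) c (∑ Is length) (# (small? k) Is) ⟩
    length I + ∑ Is length + k * (c + # (small? k) Is)      ∎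
    where
    open ≤-Reasoning
    c = # (small? k) (I ∷ [])
    eq : ∀ k l → k * suc l ≡ k + k * l
    eq = solve-∀
    eq₂ : ∀ k a c s t → a + k * c + (s + k * t) ≡ a + s + k * (c + t)
    eq₂ = solve-∀
    one : k ≤ length I + k * # (small? k) (I ∷ [])
    one with length I ≤? k
    ... | yes p = subst (λ c → k ≤ length I + k * c) (sym (cong length (filter-accept (small? k) {x = I} {xs = []} p)))
                    (≤-trans (≤-reflexive (sym (*-identityʳ k))) (m≤n+m (k * 1) (length I)))
    ... | no  p = ≤-trans (<⇒≤ (≰⇒> p)) (m≤m+n _ _)

  -- In a clique-free graph with many independent sets, a typical one is large: there are at most
  -- (|T| + 1)^(2K) of size ≤ 2K, and |T| is polylogarithmic in their number by the Ramsey bound.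
  mean-independent-size : ∀ K p r {T} → (∀ j → p ≤ j → 2 * suc j ^ (r * (2 * K)) ≤ 2 ^ j) →
    Unique T → CliqueFree (suc r) T → K * length (indeps T) ≤ K * 2 ^ p + ∑ (indeps T) length
  mean-independent-size K p r {T} growth u cf with length (indeps T) ≤? 2 ^ p
  ... | yes few = ≤-trans (*-monoʳ-≤ K few) (m≤m+n _ _)
  ... | no  many = ≤-trans bound (m≤n+m _ (K * 2 ^ p))
    where
    open ≤-Reasoning
    i = length (indeps T)
    log : ∃ λ j → 2 ^ j ≤ i × i < 2 ^ suc j
    log = log₂-bounds (≤-trans (s≤s z≤n) (≰⇒> many))
    j = proj₁ log
    p≤j : p ≤ j
    p≤j with p ≤? j
    ... | yes q = q
    ... | no  q = ⊥-elim (<⇒≱ (<-≤-trans (proj₂ (proj₂ log)) (^-monoʳ-≤ 2 (≰⇒> q))) (<⇒≤ (≰⇒> many)))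
    |T|<  : suc (length T) ≤ suc j ^ r
    |T|< with suc j ^ r ≤? length T
    ... | yes q = ⊥-elim (<⇒≱ (proj₂ (proj₂ log)) (ramsey r (suc j) u cf q))
    ... | no  q = ≰⇒> q
    c = # (small? (2 * K)) (indeps T)
    -- At most half of the sets have size at most 2K, so the mean is at least half of 2K.
    half : 2 * c ≤ i
    half = begin
      2 * c                         ≤⟨ *-monoʳ-≤ 2 (count-small (2 * K) T) ⟩
      2 * suc (length T) ^ (2 * K)  ≤⟨ *-monoʳ-≤ 2 (^-monoˡ-≤ (2 * K) |T|<) ⟩
      2 * (suc j ^ r) ^ (2 * K)     ≡⟨ cong (2 *_) (^-*-assoc (suc j) r (2 * K)) ⟩
      2 * suc j ^ (r * (2 * K))     ≤⟨ growth j p≤j ⟩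
      2 ^ j                         ≤⟨ proj₁ (proj₂ log) ⟩
      i                             ∎
    bound : K * i ≤ ∑ (indeps T) length
    bound = +-cancelʳ-≤ (K * i) (K * i) (∑ (indeps T) length) (begin
      K * i + K * i                      ≡⟨ eq K i ⟩
      2 * K * i                          ≤⟨ large-total (2 * K) (indeps T) ⟩
      ∑ (indeps T) length + 2 * K * c    ≡⟨ cong (∑ (indeps T) length +_) (eq₂ K c) ⟩
      ∑ (indeps T) length + K * (2 * c)  ≤⟨ +-monoʳ-≤ (∑ (indeps T) length) (*-monoʳ-≤ K half) ⟩
      ∑ (indeps T) length + K * i        ∎)
      where
      eq : ∀ K i → K * i + K * i ≡ 2 * K * i
      eq = solve-∀
      eq₂ : ∀ K c → 2 * K * c ≡ K * (2 * c)
      eq₂ = solve-∀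

-- Colourings and the recolouring map

vectors : ∀ {A : Set} {m} → (Fin m → List A) → List (Vec A m)
vectors {m = zero}  D = [] ∷ []
vectors {m = suc m} D = cartesianProductWith _∷_ (D zero) (vectors (λ i → D (suc i)))

∈-vectors⁺ : ∀ {A : Set} {m} (D : Fin m → List A) (c : Vec A m) → (∀ i → c at i ∈ D i) → c ∈ vectors D
∈-vectors⁺ D []      h = here refl
∈-vectors⁺ D (x ∷ c) h = ∈-cartesianProductWith⁺ _∷_ (h zero) (∈-vectors⁺ _ c (λ i → h (suc i)))

∈-vectors⁻ : ∀ {A : Set} {m} (D : Fin m → List A) {c : Vec A m} → c ∈ vectors D → ∀ i → c at i ∈ D i
∈-vectors⁻ {m = suc m} D c∈ i with ∈-cartesianProductWith⁻ _∷_ (D zero) (vectors (λ i → D (suc i))) c∈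
∈-vectors⁻ {m = suc m} D c∈ zero    | x , c , x∈ , c∈′ , refl = x∈
∈-vectors⁻ {m = suc m} D c∈ (suc i) | x , c , x∈ , c∈′ , refl = ∈-vectors⁻ _ c∈′ i

vectors-unique : ∀ {A : Set} {m} (D : Fin m → List A) → (∀ i → Unique (D i)) → Unique (vectors D)
vectors-unique {m = zero}  D u = [] ∷ []
vectors-unique {m = suc m} D u = Unique.cartesianProductWith⁺ _∷_ (λ { refl → refl , refl })
  (u zero) (vectors-unique _ (λ i → u (suc i)))

-- Colourings are vectors rather than functions for the sake of this: pointwise equal ones are
-- equal, so lists of them can be duplicate-free up to `≡`.
at-ext : ∀ {A : Set} {m} {c d : Vec A m} → (∀ i → c at i ≡ d at i) → c ≡ d
at-ext {c = c} {d} h = trans (sym (tabulate∘lookup c)) (trans (tabulate-cong h) (tabulate∘lookup d))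

_≟ᴹ_ : (a b : Maybe ℕ) → Dec (a ≡ b)
_≟ᴹ_ = maybe-≡-dec ℕ._≟_

module Colourings (G : Graph) (L : Fin (n G) → List ℕ) (L-unique : ∀ v → Unique (L v)) where

  open IndependentSets (adj? G)

  Vertex : Set
  Vertex = Fin (n G)

  -- nothing marks an uncoloured vertex.
  Colouring : Set
  Colouring = Vec (Maybe ℕ) (n G)

  VSet : Set
  VSet = Vec Bool (n G)

  open DecMembership (Fin._≟_ {n G}) using (_∈?_)
  open DecMembership _≟ᴹ_ using () renaming (_∈?_ to _∈ᴹ?_)

  nbrs : Vertex → List Vertex
  nbrs v = filter (adj? G v) (allFin (n G))

  nbrs-unique : ∀ v → Unique (nbrs v)
  nbrs-unique v = Unique.filter⁺ (adj? G v) (Unique.allFin⁺ (n G))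

  ∈-nbrs⁺ : ∀ {v u} → Adj G v u → u ∈ nbrs v
  ∈-nbrs⁺ {v} {u} a = ∈-filter⁺ (adj? G v) (∈-allFin u) a

  ∈-nbrs⁻ : ∀ {v u} → u ∈ nbrs v → Adj G v u
  ∈-nbrs⁻ {v} p = proj₂ (∈-filter⁻ (adj? G v) {xs = allFin (n G)} p)

  choices : Bool → Vertex → List (Maybe ℕ)
  choices true  u = map just (L u)
  choices false u = nothing ∷ []

  choices-unique : ∀ b u → Unique (choices b u)
  choices-unique true  u = Unique.map⁺ just-injective (L-unique u)
  choices-unique false u = [] ∷ []

  Proper : Colouring → Set
  Proper c = ∀ u w → Adj G u w → c at u ≡ c at w → c at u ≡ nothing

  proper? : ∀ c → Dec (Proper c)
  proper? c = all? λ u → all? λ w → adj? G u w →-dec ((c at u) ≟ᴹ (c at w) →-dec (c at u) ≟ᴹ nothing)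

  record IsColouring (S : VSet) (c : Colouring) : Set where
    constructor isColouring
    field
      chosen : ∀ u → c at u ∈ choices (S at u) u
      proper : Proper c

  open IsColouring

  cols : VSet → List Colouring
  cols S = filter proper? (vectors (λ u → choices (S at u) u))

  cols-unique : ∀ S → Unique (cols S)
  cols-unique S = Unique.filter⁺ proper? (vectors-unique _ (λ u → choices-unique (S at u) u))

  ∈-cols⁺ : ∀ S {c} → IsColouring S c → c ∈ cols S
  ∈-cols⁺ S {c} h = ∈-filter⁺ proper? (∈-vectors⁺ _ c (chosen h)) (proper h)

  ∈-cols⁻ : ∀ S {c} → c ∈ cols S → IsColouring S c
  ∈-cols⁻ S p = let (c∈ , pr) = ∈-filter⁻ proper? {xs = vectors (λ u → choices (S at u) u)} p in
    isColouring (∈-vectors⁻ _ c∈) pr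

  coloured⇒true : ∀ {S c u} → IsColouring S c → c at u ≢ nothing → S at u ≡ true
  coloured⇒true {S} {c} {u} h coloured with S at u | chosen h u
  ... | true  | _        = refl
  ... | false | here eq  = ⊥-elim (coloured eq)

  colour∈L : ∀ {S c u x} → IsColouring S c → c at u ≡ just x → x ∈ L u
  colour∈L {S} {c} {u} h eq with S at u | chosen h u
  ... | false | here eq′ with () ← trans (sym eq) eq′
  ... | true  | p with ∈-map⁻ just p
  ...   | y , y∈ , eq′ = subst (_∈ L u) (just-injective (trans (sym eq′) eq)) y∈

  true⇒coloured : ∀ {S c u} → IsColouring S c → S at u ≡ true → ∃ λ x → c at u ≡ just x
  true⇒coloured {S} {c} {u} h eq with S at u | chosen h u
  true⇒coloured h refl | true | p with ∈-map⁻ just p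
  ... | x , _ , eq = x , eq

  false⇒uncoloured : ∀ {S c u} → IsColouring S c → S at u ≡ false → c at u ≡ nothing
  false⇒uncoloured {S} {c} {u} h eq with S at u | chosen h u
  false⇒uncoloured h refl | false | here eq = eq

  choose : ∀ {S : VSet} {u y} → S at u ≡ true → y ∈ L u → just y ∈ choices (S at u) u
  choose {u = u} eq y∈ = subst (λ b → just _ ∈ choices b u) (sym eq) (∈-map⁺ just y∈)

  -- Phrased through the list of colours around `u`, so that `avail` is visibly a function of that
  -- list and `avail-cong` is a congruence.
  free? : ∀ (c : Colouring) u x → Dec (just x ∉ map (c at_) (nbrs u))
  free? c u x = ¬? (just x ∈ᴹ? map (c at_) (nbrs u))

  avail : Colouring → Vertex → List ℕ
  avail c u = filter (free? c u) (L u)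

  avail-unique : ∀ c u → Unique (avail c u)
  avail-unique c u = Unique.filter⁺ (free? c u) (L-unique u)

  ∈-avail⁺ : ∀ c {u x} → x ∈ L u → (∀ w → Adj G u w → c at w ≢ just x) → x ∈ avail c u
  ∈-avail⁺ c {u} x∈ h = ∈-filter⁺ (free? c u) x∈ λ p →
    let (w , w∈ , eq) = ∈-map⁻ (c at_) p in h w (∈-nbrs⁻ w∈) (sym eq)

  ∈-avail⁻ : ∀ c {u x} → x ∈ avail c u → x ∈ L u × (∀ w → Adj G u w → c at w ≢ just x)
  ∈-avail⁻ c {u} p with ∈-filter⁻ (free? c u) {xs = L u} p
  ... | x∈ , h = x∈ , λ w a eq → h (subst (_∈ map (c at_) (nbrs u)) eq (∈-map⁺ (c at_) (∈-nbrs⁺ a)))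

  avail-cong : ∀ c d {u} → (∀ w → Adj G u w → c at w ≡ d at w) → avail c u ≡ avail d u
  avail-cong c d {u} h =
    cong (λ used → filter (λ x → ¬? (just x ∈ᴹ? used)) (L u))
      (map-cong-local {xs = nbrs u} (All.tabulate λ {w} p → h w (∈-nbrs⁻ p)))

  -- Availability at `u` looks at neighbours only, so a coloured vertex always has its own colour
  -- available. A single available colour therefore determines the colour of the vertex.
  own∈avail : ∀ {S c u x} → IsColouring S c → c at u ≡ just x → x ∈ avail c u
  own∈avail {c = c} {u} h eq = ∈-avail⁺ c (colour∈L h eq) λ w a eq′ →
    case-⊥ (trans (sym eq) (proper h u w a (trans eq (sym eq′))))
    where
    case-⊥ : ∀ {x : ℕ} → just x ≡ nothing → ⊥
    case-⊥ ()

  module Recolouring (x : ℕ) where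

    other? : ∀ y → Dec (y ≢ x)
    other? y = ¬? (y ℕ.≟ x)

    -- A canonical choice that depends on `c` only through the neighbours of `u`, hence the same
    -- before and after `u` is recoloured.
    alt : Colouring → Vertex → Maybe ℕ
    alt c u = head (filter other? (avail c u))

    alt-just : ∀ c {u y} → alt c u ≡ just y → y ∈ avail c u × y ≢ x
    alt-just c {u} eq with filter other? (avail c u) in e
    alt-just c {u} refl | y ∷ _ = ∈-filter⁻ other? {xs = avail c u} (subst (y ∈_) (sym e) (here refl))

    alt-nothing : ∀ c {u} → alt c u ≡ nothing → length (avail c u) ≤ 1
    alt-nothing c {u} eq = length-⊆ {ys = x ∷ []} (avail-unique c u) sub
      where
      sub : ∀ {y} → y ∈ avail c u → y ∈ x ∷ []
      sub {y} y∈ with y ℕ.≟ x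
      ... | yes e = here e
      ... | no ne = ⊥-elim (nonempty (∈-filter⁺ other? y∈ ne) eq)
        where
        nonempty : ∀ {zs : List ℕ} {z} → z ∈ zs → head zs ≢ nothing
        nonempty (here _)  ()
        nonempty (there _) ()

    alt-cong : ∀ c d {u} → (∀ w → Adj G u w → c at w ≡ d at w) → alt c u ≡ alt d u
    alt-cong c d h = cong (λ a → head (filter other? a)) (avail-cong c d h)

    override : (Vertex → Maybe ℕ) → List Vertex → Colouring → Colouring
    override f I c = tabulate λ u → if does (u ∈? I) then f u else c at u

    override-∈ : ∀ f I c {u} → u ∈ I → override f I c at u ≡ f u
    override-∈ f I c {u} u∈ = trans (lookup∘tabulate _ u) eq
      where
      eq : (if does (u ∈? I) then f u else c at u) ≡ f u
      eq with u ∈? I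
      ... | yes _ = refl
      ... | no  p = ⊥-elim (p u∈)

    override-∉ : ∀ f I c {u} → u ∉ I → override f I c at u ≡ c at u
    override-∉ f I c {u} u∉ = trans (lookup∘tabulate _ u) eq
      where
      eq : (if does (u ∈? I) then f u else c at u) ≡ c at u
      eq with u ∈? I
      ... | yes p = ⊥-elim (u∉ p)
      ... | no  _ = refl

    module At (v : Vertex) where

      Switchable : Colouring → Vertex → Set
      Switchable c u = c at u ≡ just x × alt c u ≢ nothing

      switchable? : ∀ c u → Dec (Switchable c u)
      switchable? c u = (c at u) ≟ᴹ just x ×-dec ¬? (alt c u ≟ᴹ nothing)

      switchables : Colouring → List Vertex
      switchables c = filter (switchable? c) (nbrs v)

      -- The vertices that could owe their present colour to a switch away from `x`; those among the
      -- neighbours form the set T(c′) of the overview. The last condition excludes uncoloured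
      -- vertices without an alternative, where both sides of the equation are `nothing`.
      Switched : Colouring → Vertex → Set
      Switched c u = x ∈ avail c u × c at u ≡ alt c u × c at u ≢ nothing

      switched? : ∀ c u → Dec (Switched c u)
      switched? c u = x ∈ⁿ? avail c u ×-dec ((c at u) ≟ᴹ alt c u ×-dec ¬? ((c at u) ≟ᴹ nothing))
        where open DecMembership ℕ._≟_ using () renaming (_∈?_ to _∈ⁿ?_)

      switcheds : Colouring → List Vertex
      switcheds c = filter (switched? c) (nbrs v)

      remove : Colouring → Colouring
      remove c = override (alt c) (switchables c) c

      insert : Colouring → List Vertex → Colouring
      insert c I = override (λ _ → just x) I c

      ∈-switchables⁻ : ∀ c {u} → u ∈ switchables c → u ∈ nbrs v × Switchable c u
      ∈-switchables⁻ c = ∈-filter⁻ (switchable? c) {xs = nbrs v}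

      ∈-switcheds⁻ : ∀ c {u} → u ∈ switcheds c → u ∈ nbrs v × Switched c u
      ∈-switcheds⁻ c = ∈-filter⁻ (switched? c) {xs = nbrs v}

      just≢nothing : ∀ {y : ℕ} {a : Maybe ℕ} → a ≡ just y → a ≢ nothing
      just≢nothing refl ()

      ≢nothing⇒just : ∀ {a : Maybe ℕ} → a ≢ nothing → ∃ λ y → a ≡ just y
      ≢nothing⇒just {just y}  _ = y , refl
      ≢nothing⇒just {nothing} h = ⊥-elim (h refl)

      module _ {S c} (isC : IsColouring S c) where

        no-conflict : ∀ {u w} → c at u ≡ just x → Adj G u w → c at w ≢ just x
        no-conflict cu a cw = just≢nothing cu (proper isC _ _ a (trans cu (sym cw)))

        -- Only vertices coloured `x` are switched, and by properness none of them is next to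
        -- another. So alternatives at such vertices survive the switch.
        remove-nearby : ∀ {u} → c at u ≡ just x → ∀ w → Adj G u w → remove c at w ≡ c at w
        remove-nearby cu w a = override-∉ (alt c) (switchables c) c λ p →
          no-conflict cu a (proj₁ (proj₂ (∈-switchables⁻ c p)))

        remove-isColouring : IsColouring S (remove c)
        remove-isColouring = isColouring ch pr
          where
          ch : ∀ u → remove c at u ∈ choices (S at u) u
          ch u with u ∈? switchables c
          ... | no u∉ = subst (_∈ choices (S at u) u) (sym (override-∉ (alt c) (switchables c) c u∉)) (chosen isC u)
          ... | yes u∈ with ∈-switchables⁻ c u∈
          ...   | _ , cu , alt≢ with ≢nothing⇒just alt≢
          ...     | y , eq = subst (_∈ choices (S at u) u) (sym (trans (override-∈ (alt c) (switchables c) c u∈) eq))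
            (choose {S = S} (coloured⇒true isC (just≢nothing cu)) (proj₁ (∈-avail⁻ c {u} (proj₁ (alt-just c {u} eq)))))
          mixed : ∀ {u w} → Adj G u w → u ∈ switchables c → remove c at u ≢ remove c at w
          mixed {u} {w} a u∈ eq with ∈-switchables⁻ c u∈
          ... | _ , cu , alt≢ with ≢nothing⇒just alt≢
          ...   | y , e = proj₂ (∈-avail⁻ c {u} (proj₁ (alt-just c {u} e))) w a
            (trans (sym (remove-nearby cu w a)) (trans (sym eq) (trans (override-∈ (alt c) (switchables c) c u∈) e)))
          pr : Proper (remove c)
          pr u w a eq with u ∈? switchables c | w ∈? switchables c
          ... | yes u∈ | _      = ⊥-elim (mixed a u∈ eq)
          ... | no  _  | yes w∈ = ⊥-elim (mixed (Graph.sym G a) w∈ (sym eq))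
          ... | no u∉  | no w∉  = trans ru (proper isC u w a (trans (sym ru) (trans eq (override-∉ (alt c) (switchables c) c w∉))))
            where ru = override-∉ (alt c) (switchables c) c u∉

        -- A switched vertex has left `x`. A neighbour of `v` that kept `x` had no alternative and
        -- gains none, since the colours around it are unchanged.
        remove-clear : switchables (remove c) ≡ []
        remove-clear with switchables (remove c) in eq
        ... | [] = refl
        ... | u ∷ _ with ∈-switchables⁻ (remove c) (subst (u ∈_) (sym eq) (here refl))
        ...   | u∈N , ru , alt≢ with u ∈? switchables c
        ...     | yes u∈ = ⊥-elim (proj₂ (alt-just c {u} (trans (sym (override-∈ (alt c) (switchables c) c u∈)) ru)) refl)
        ...     | no  u∉ = ⊥-elim (u∉ (∈-filter⁺ (switchable? c) u∈N (cu , λ e → alt≢ (trans (alt-cong (remove c) c (remove-nearby cu)) e))))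
          where cu = trans (sym (override-∉ (alt c) (switchables c) c u∉)) ru

        -- They share the colour `x`, so they are pairwise nonadjacent; each of them ends up with
        -- its alternative and still has `x` available.
        switchables-independent : switchables c ∈ indeps (switcheds (remove c))
        switchables-independent = ∈-indeps⁺
          (filter-⊆-filter (switchable? c) (switched? (remove c)) (nbrs v) switch)
          (allPairs-membership (switchables c) λ p q a →
            no-conflict (proj₁ (proj₂ (∈-switchables⁻ c p))) a (proj₁ (proj₂ (∈-switchables⁻ c q))))
          where
          switch : ∀ {u} → u ∈ nbrs v → Switchable c u → Switched (remove c) u
          switch {u} u∈N s@(cu , alt≢) =
            subst (x ∈_) (sym (avail-cong (remove c) c near)) (own∈avail isC cu) ,
            trans ru (sym (alt-cong (remove c) c near)) ,
            λ e → alt≢ (trans (sym ru) e)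
            where
            near = remove-nearby cu
            ru = override-∈ (alt c) (switchables c) c (∈-filter⁺ (switchable? c) u∈N s)

        insert-remove : insert (remove c) (switchables c) ≡ c
        insert-remove = at-ext λ u → go u (u ∈? switchables c)
          where
          go : ∀ u → Dec (u ∈ switchables c) → insert (remove c) (switchables c) at u ≡ c at u
          go u (yes u∈) = trans (override-∈ (λ _ → just x) (switchables c) (remove c) u∈)
                                (sym (proj₁ (proj₂ (∈-switchables⁻ c u∈))))
          go u (no  u∉) = trans (override-∉ (λ _ → just x) (switchables c) (remove c) u∉)
                                (override-∉ (alt c) (switchables c) c u∉)

      module _ {S c I} (isC : IsColouring S c) (clear : switchables c ≡ []) (I∈ : I ∈ indeps (switcheds c)) where

        private
          d = insert c I

        member : ∀ {u} → u ∈ I → u ∈ nbrs v × Switched c u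
        member p = ∈-switcheds⁻ c (lookup (proj₁ (∈-indeps⁻ (switcheds c) I∈)) p)

        at-∈ : ∀ {u} → u ∈ I → d at u ≡ just x
        at-∈ = override-∈ (λ _ → just x) I c

        at-∉ : ∀ {u} → u ∉ I → d at u ≡ c at u
        at-∉ = override-∉ (λ _ → just x) I c

        independent : ∀ {u w} → u ∈ I → Adj G u w → w ∉ I
        independent u∈ a w∈ = allPairs-lookup {R = NonAdj} (irr G) (λ na b → na (Graph.sym G b))
          (proj₂ (∈-indeps⁻ (switcheds c) I∈)) u∈ w∈ a

        x∉nearby : ∀ {u w} → u ∈ I → Adj G u w → c at w ≢ just x
        x∉nearby {u} {w} u∈ a = proj₂ (∈-avail⁻ c {u} (proj₁ (proj₂ (member u∈)))) w a

        nearby-∈ : ∀ {u} → u ∈ I → ∀ w → Adj G u w → d at w ≡ c at w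
        nearby-∈ u∈ w a = at-∉ (independent u∈ a)

        -- A vertex of `I` has `x` available in `c`, so it is not adjacent to a vertex that `c`
        -- colours `x`.
        nearby-x : ∀ {u} → c at u ≡ just x → ∀ w → Adj G u w → d at w ≡ c at w
        nearby-x cu w a = at-∉ λ w∈ → x∉nearby w∈ (Graph.sym G a) cu

        insert-isColouring : IsColouring S d
        insert-isColouring = isColouring ch pr
          where
          ch : ∀ u → d at u ∈ choices (S at u) u
          ch u with u ∈? I
          ... | no u∉ = subst (_∈ choices (S at u) u) (sym (at-∉ u∉)) (chosen isC u)
          ... | yes u∈ = subst (_∈ choices (S at u) u) (sym (at-∈ u∈))
            (choose {S = S} (coloured⇒true isC (proj₂ (proj₂ (proj₂ (member u∈)))))
              (proj₁ (∈-avail⁻ c {u} (proj₁ (proj₂ (member u∈))))))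
          mixed : ∀ {u w} → Adj G u w → u ∈ I → d at u ≢ d at w
          mixed a u∈ eq = x∉nearby u∈ a (trans (sym (nearby-∈ u∈ _ a)) (trans (sym eq) (at-∈ u∈)))
          pr : Proper d
          pr u w a eq with u ∈? I | w ∈? I
          ... | yes u∈ | _      = ⊥-elim (mixed a u∈ eq)
          ... | no  _  | yes w∈ = ⊥-elim (mixed (Graph.sym G a) w∈ (sym eq))
          ... | no u∉  | no w∉  = trans (at-∉ u∉) (proper isC u w a (trans (sym (at-∉ u∉)) (trans eq (at-∉ w∉))))

        -- Members of `I` can return to their colour in `c`, which is still their alternative. Any
        -- other switchable vertex would be coloured `x` with the same surroundings in `c`, against
        -- `clear`.
        switchables-insert : switchables d ≡ I
        switchables-insert = filter-sublist (switchable? d)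
          (⊆-trans (proj₁ (∈-indeps⁻ (switcheds c) I∈)) (filter-⊆ (switched? c) (nbrs v)))
          (nbrs-unique v) to from
          where
          to : ∀ {u} → u ∈ I → Switchable d u
          to u∈ with member u∈
          ... | _ , _ , eq , coloured = at-∈ u∈ ,
            λ e → coloured (trans eq (trans (sym (alt-cong d c (nearby-∈ u∈))) e))
          from : ∀ {u} → u ∈ nbrs v → Switchable d u → u ∈ I
          from {u} u∈N (du , alt≢) with u ∈? I
          ... | yes u∈ = u∈
          ... | no  u∉ = ⊥-elim (empty (subst (u ∈_) clear
              (∈-filter⁺ (switchable? c) u∈N (cu , λ e → alt≢ (trans (alt-cong d c (nearby-x cu)) e)))))
            where
            cu = trans (sym (at-∉ u∉)) du
            empty : u ∈ [] → ⊥
            empty ()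

        remove-insert : remove d ≡ c
        remove-insert = at-ext λ u → go u (u ∈? I)
          where
          go : ∀ u → Dec (u ∈ I) → remove d at u ≡ c at u
          go u (yes u∈) = trans (override-∈ (alt d) (switchables d) d (subst (u ∈_) (sym switchables-insert) u∈))
            (trans (alt-cong d c (nearby-∈ u∈)) (sym (proj₁ (proj₂ (proj₂ (member u∈))))))
          go u (no  u∉) = trans (override-∉ (alt d) (switchables d) d (λ p → u∉ (subst (u ∈_) switchables-insert p)))
            (at-∉ u∉)

-- Counting fibres, extensions and stuck vertices

module Counting (G : Graph) (L : Fin (n G) → List ℕ) (L-unique : ∀ v → Unique (L v)) where

  open IndependentSets (adj? G)
  open Colourings G L L-unique
  open IsColouring

  module Fibres (x : ℕ) (v : Vertex) where

    open Recolouring x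
    open At v

    clear? : ∀ c → Dec (switchables c ≡ [])
    clear? c = null? (switchables c)

    -- Recolouring the switchable vertices partitions the colourings into fibres, one for each
    -- clear colouring, and the fibre of c consists of the recolourings of independent sets.
    fibre-count : ∀ S K M → (∀ {c} → c ∈ cols S →
        K * length (indeps (switcheds c)) ≤ K * M + ∑ (indeps (switcheds c)) length) →
      K * length (cols S) ≤ K * M * # clear? (cols S) + ∑ (cols S) (λ c → length (switchables c))
    fibre-count S K M mean = begin
      K * length (cols S)
        -- `W` joins all fibres. Its length is compared using that it covers `cols S`, the sum of
        -- the sizes using that it lies in `cols S` without repetition. The term `K * M` is paid
        -- once per fibre, that is, once per clear colouring.
        ≤⟨ *-monoʳ-≤ K (length-⊆ (cols-unique S) cols⊆W) ⟩
      K * length W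
        ≡⟨ cong (K *_) (length-concatMap fibre Φ) ⟩
      K * ∑ Φ (λ c → length (fibre c))
        ≡⟨ sym (∑-distribˡ-* K Φ _) ⟩
      ∑ Φ (λ c → K * length (fibre c))
        ≤⟨ ∑-mono Φ per-fibre ⟩
      ∑ Φ (λ c → K * M + ∑ (fibre c) (λ d → length (switchables d)))
        ≡⟨ ∑-distrib-+ Φ _ _ ⟩
      ∑ Φ (λ _ → K * M) + ∑ Φ (λ c → ∑ (fibre c) (λ d → length (switchables d)))
        ≡⟨ cong₂ _+_ (trans (∑-const Φ (K * M)) (*-comm (length Φ) (K * M))) (sym (∑-concatMap fibre Φ _)) ⟩
      K * M * length Φ + ∑ W (λ d → length (switchables d))
        ≤⟨ +-monoʳ-≤ (K * M * length Φ) (∑-⊆ (λ d → length (switchables d)) W-unique W⊆cols) ⟩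
      K * M * length Φ + ∑ (cols S) (λ c → length (switchables c)) ∎
      where
      open ≤-Reasoning
      Φ : List Colouring
      Φ = filter clear? (cols S)
      fibre : Colouring → List Colouring
      fibre c = map (insert c) (indeps (switcheds c))
      W : List Colouring
      W = concatMap fibre Φ
      Φ⁻ : ∀ {c} → c ∈ Φ → c ∈ cols S × switchables c ≡ []
      Φ⁻ = ∈-filter⁻ clear? {xs = cols S}
      cols⊆W : ∀ {c} → c ∈ cols S → c ∈ W
      cols⊆W {c} c∈ = ∈-concatMap⁺ fibre (lose
        (∈-filter⁺ clear? (∈-cols⁺ S (remove-isColouring isC)) (remove-clear isC))
        (subst (_∈ fibre (remove c)) (insert-remove isC)
          (∈-map⁺ (insert (remove c)) (switchables-independent isC))))
        where isC = ∈-cols⁻ S c∈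
      W⊆cols : ∀ {d} → d ∈ W → d ∈ cols S
      W⊆cols d∈ with find (∈-concatMap⁻ fibre {xs = Φ} d∈)
      ... | c , c∈ , d∈′ with ∈-map⁻ (insert c) d∈′
      ...   | I , I∈ , refl = ∈-cols⁺ S (insert-isColouring (∈-cols⁻ S (proj₁ (Φ⁻ c∈))) (proj₂ (Φ⁻ c∈)) I∈)
      fibre-unique : ∀ {c} → c ∈ Φ → Unique (fibre c)
      fibre-unique {c} c∈ = unique-map switchables
        (switchables-insert (∈-cols⁻ S (proj₁ (Φ⁻ c∈))) (proj₂ (Φ⁻ c∈)))
        (indeps-unique (Unique.filter⁺ (switched? c) (nbrs-unique v)))
      fibre-remove : ∀ {c d} → c ∈ Φ → d ∈ fibre c → remove d ≡ c
      fibre-remove {c} c∈ d∈ with ∈-map⁻ (insert c) d∈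
      ... | I , I∈ , refl = remove-insert (∈-cols⁻ S (proj₁ (Φ⁻ c∈))) (proj₂ (Φ⁻ c∈)) I∈
      W-unique : Unique W
      W-unique = unique-concatMap fibre remove fibre-unique fibre-remove (Unique.filter⁺ clear? (cols-unique S))
      per-fibre : ∀ {c} → c ∈ Φ →
        K * length (fibre c) ≤ K * M + ∑ (fibre c) (λ d → length (switchables d))
      per-fibre {c} c∈ = begin
        K * length (fibre c)
          ≡⟨ cong (K *_) (length-map (insert c) (indeps (switcheds c))) ⟩
        K * length (indeps (switcheds c))
          ≤⟨ mean (proj₁ (Φ⁻ c∈)) ⟩
        K * M + ∑ (indeps (switcheds c)) length
          ≤⟨ +-monoʳ-≤ (K * M) (∑-mono (indeps (switcheds c)) λ I∈ → ≤-reflexive (cong length (sym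
               (switchables-insert (∈-cols⁻ S (proj₁ (Φ⁻ c∈))) (proj₂ (Φ⁻ c∈)) I∈)))) ⟩
        K * M + ∑ (indeps (switcheds c)) (λ I → length (switchables (insert c I)))
          ≡⟨ cong (K * M +_) (sym (∑-map (insert c) (indeps (switcheds c)) _)) ⟩
        K * M + ∑ (fibre c) (λ d → length (switchables d)) ∎

  at-update-≢ : ∀ {A : Set} (c : Vec A (n G)) {u w a} → u ≢ w → (c [ w ]≔ a) at u ≡ c at u
  at-update-≢ c ne = lookup∘update′ ne c _

  adj⇒≢ : ∀ {u w} → Adj G u w → u ≢ w
  adj⇒≢ a refl = irr G a

  extend-isColouring : ∀ {S c v x} → IsColouring S c → x ∈ avail c v →
    IsColouring (S [ v ]≔ true) (c [ v ]≔ just x)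
  extend-isColouring {S} {c} {v} {x} isC x∈ = isColouring ch pr
    where
    d = c [ v ]≔ just x
    ch : ∀ u → d at u ∈ choices ((S [ v ]≔ true) at u) u
    ch u with u Fin.≟ v
    ... | yes refl = subst (_∈ choices ((S [ v ]≔ true) at u) u) (sym (lookup∘update v c (just x)))
                       (choose {S = S [ v ]≔ true} (lookup∘update v S true) (proj₁ (∈-avail⁻ c x∈)))
    ... | no ne = subst (λ b → d at u ∈ choices b u) (sym (at-update-≢ S ne))
                    (subst (_∈ choices (S at u) u) (sym (at-update-≢ c ne)) (chosen isC u))
    mixed : ∀ {w} → Adj G v w → d at v ≢ d at w
    mixed {w} a eq = proj₂ (∈-avail⁻ c x∈) w a
      (trans (sym (at-update-≢ c (λ e → adj⇒≢ a (sym e)))) (trans (sym eq) (lookup∘update v c (just x))))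
    pr : Proper d
    pr u w a eq with u Fin.≟ v | w Fin.≟ v
    ... | yes refl | _        = ⊥-elim (mixed a eq)
    ... | no  _    | yes refl = ⊥-elim (mixed (Graph.sym G a) (sym eq))
    ... | no u≢    | no w≢    = trans (at-update-≢ c u≢)
      (proper isC u w a (trans (sym (at-update-≢ c u≢)) (trans eq (at-update-≢ c w≢))))

  erase-isColouring : ∀ {S c} u → IsColouring S c → IsColouring (S [ u ]≔ false) (c [ u ]≔ nothing)
  erase-isColouring {S} {c} u isC = isColouring ch pr
    where
    d = c [ u ]≔ nothing
    ch : ∀ w → d at w ∈ choices ((S [ u ]≔ false) at w) w
    ch w with w Fin.≟ u
    ... | yes refl = subst (λ b → d at w ∈ choices b w) (sym (lookup∘update u S false))
                       (here (lookup∘update u c nothing))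
    ... | no ne = subst (λ b → d at w ∈ choices b w) (sym (at-update-≢ S ne))
                    (subst (_∈ choices (S at w) w) (sym (at-update-≢ c ne)) (chosen isC w))
    pr : Proper d
    pr w z a eq with w Fin.≟ u | z Fin.≟ u
    ... | yes refl | _        = lookup∘update w c nothing
    ... | no  _    | yes refl = trans eq (lookup∘update z c nothing)
    ... | no w≢    | no z≢    = trans (at-update-≢ c w≢)
      (proper isC w z a (trans (sym (at-update-≢ c w≢)) (trans eq (at-update-≢ c z≢))))

  -- Erasing `v` recovers `c`, where `v` is uncoloured, and the entry at `v` recovers the colour;
  -- distinct pairs thus give distinct colourings.
  count-extensions : ∀ S {v} → S at v ≡ false →
    ∑ (cols S) (λ c → length (avail c v)) ≤ length (cols (S [ v ]≔ true))
  count-extensions S {v} v∉ = begin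
    ∑ (cols S) (λ c → length (avail c v))
      ≡⟨ ∑-cong (cols S) (λ c → sym (length-map (λ x → c [ v ]≔ just x) (avail c v))) ⟩
    ∑ (cols S) (λ c → length (extensions c))
      ≡⟨ sym (length-concatMap extensions (cols S)) ⟩
    length (concatMap extensions (cols S))
      ≤⟨ length-⊆ unique sub ⟩
    length (cols (S [ v ]≔ true)) ∎
    where
    open ≤-Reasoning
    extensions : Colouring → List Colouring
    extensions c = map (λ x → c [ v ]≔ just x) (avail c v)
    sub : ∀ {d} → d ∈ concatMap extensions (cols S) → d ∈ cols (S [ v ]≔ true)
    sub d∈ with find (∈-concatMap⁻ extensions {xs = cols S} d∈)
    ... | c , c∈ , d∈′ with ∈-map⁻ (λ x → c [ v ]≔ just x) d∈′
    ...   | x , x∈ , refl = ∈-cols⁺ (S [ v ]≔ true) (extend-isColouring (∈-cols⁻ S c∈) x∈)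
    erase : ∀ {c d} → c ∈ cols S → d ∈ extensions c → d [ v ]≔ nothing ≡ c
    erase {c} c∈ d∈ with ∈-map⁻ (λ x → c [ v ]≔ just x) d∈
    ... | x , x∈ , refl = trans ([]≔-idempotent c v)
      (trans (cong (c [ v ]≔_) (sym (false⇒uncoloured (∈-cols⁻ S c∈) v∉))) ([]≔-lookup c v))
    unique : Unique (concatMap extensions (cols S))
    unique = unique-concatMap extensions (_[ v ]≔ nothing)
      -- The default 0 is never reached, as the entry at `v` is `just x`.
      (λ {c} _ → unique-map (λ d → fromMaybe 0 (d at v))
        (λ {x} _ → cong (fromMaybe 0) (lookup∘update v c (just x))) (avail-unique c v))
      erase (cols-unique S)

  Stuck : Colouring → Vertex → Set
  Stuck c u = c at u ≢ nothing × length (avail c u) ≤ 1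

  stuck? : ∀ c u → Dec (Stuck c u)
  stuck? c u = ¬? ((c at u) ≟ᴹ nothing) ×-dec (length (avail c u) ≤? 1)

  -- A stuck vertex can be erased without loss: its colour is recovered as the only available one.
  count-stuck : ∀ S {u} → S at u ≡ true →
    # (λ c → stuck? c u) (cols S) ≤ length (cols (S [ u ]≔ false))
  count-stuck S {u} u∈ = begin
    length X                          ≡⟨ sym (length-map (_[ u ]≔ nothing) X) ⟩
    length (map (_[ u ]≔ nothing) X)  ≤⟨ length-⊆ unique sub ⟩
    length (cols (S [ u ]≔ false))    ∎
    where
    open ≤-Reasoning
    X : List Colouring
    X = filter (λ c → stuck? c u) (cols S)
    X⁻ : ∀ {c} → c ∈ X → c ∈ cols S × Stuck c u
    X⁻ = ∈-filter⁻ (λ c → stuck? c u) {xs = cols S}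
    sub : ∀ {d} → d ∈ map (_[ u ]≔ nothing) X → d ∈ cols (S [ u ]≔ false)
    sub d∈ with ∈-map⁻ (_[ u ]≔ nothing) d∈
    ... | c , c∈ , refl = ∈-cols⁺ (S [ u ]≔ false) (erase-isColouring u (∈-cols⁻ S (proj₁ (X⁻ c∈))))
    restore : Colouring → Colouring
    restore d = d [ u ]≔ head (avail d u)
    only : ∀ {xs : List ℕ} {x} → x ∈ xs → length xs ≤ 1 → head xs ≡ just x
    only {_ ∷ []} (here refl) _ = refl
    only {_ ∷ _ ∷ _} _ (s≤s ())
    restores : ∀ {c} → c ∈ X → restore (c [ u ]≔ nothing) ≡ c
    restores {c} c∈ with X⁻ c∈
    ... | c∈′ , _ , le with true⇒coloured (∈-cols⁻ S c∈′) u∈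
    ...   | x , eq = trans ([]≔-idempotent c u) (trans (cong (c [ u ]≔_) (trans
      (cong head (avail-cong (c [ u ]≔ nothing) c λ w a → at-update-≢ c (λ e → adj⇒≢ a (sym e))))
      (trans (only (own∈avail (∈-cols⁻ S c∈′) eq) le) (sym eq)))) ([]≔-lookup c u))
    unique : Unique (map (_[ u ]≔ nothing) X)
    unique = unique-map restore restores (Unique.filter⁺ (λ c → stuck? c u) (cols-unique S))

  -- A clear colour of the list that is still used on a neighbour of `v` sits on a vertex without
  -- alternative. Each stuck neighbour carries one colour, so it blocks at most one.
  clear≤avail+stuck : ∀ {S c} v → IsColouring S c →
    # (λ x → Fibres.clear? x v c) (L v) ≤ length (avail c v) + # (stuck? c) (nbrs v)
  clear≤avail+stuck {S} {c} v isC = begin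
    length zs
      ≡⟨ sym (length-map just zs) ⟩
    length (map just zs)
      ≤⟨ length-⊆ (Unique.map⁺ just-injective (Unique.filter⁺ P? (L-unique v))) sub ⟩
    length (map just (avail c v) ++ map (c at_) stucks)
      ≡⟨ length-++ (map just (avail c v)) ⟩
    length (map just (avail c v)) + length (map (c at_) stucks)
      ≡⟨ cong₂ _+_ (length-map just (avail c v)) (length-map (c at_) stucks) ⟩
    length (avail c v) + length stucks ∎
    where
    open ≤-Reasoning
    P? = λ x → Fibres.clear? x v c
    zs = filter P? (L v)
    stucks  = filter (stuck? c) (nbrs v)
    sub : ∀ {a} → a ∈ map just zs → a ∈ map just (avail c v) ++ map (c at_) stucks
    sub a∈ with ∈-map⁻ just a∈
    ... | x , x∈zs , refl with ∈-filter⁻ P? {xs = L v} x∈zs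
    ...   | x∈ , clear with Any.any? (λ u → (c at u) ≟ᴹ just x) (nbrs v)
    ...     | no unused = ∈-++⁺ˡ (∈-map⁺ just (∈-avail⁺ c x∈ λ w a eq → unused (lose (∈-nbrs⁺ a) eq)))
    ...     | yes used with find used
    ...       | u , u∈ , eq = ∈-++⁺ʳ (map just (avail c v))
        (subst (_∈ map (c at_) stucks) eq (∈-map⁺ (c at_) (∈-filter⁺ (stuck? c) u∈ (just≢nothing eq , single))))
      where
      open Recolouring x
      open At v
      single : length (avail c u) ≤ 1
      single with alt c u ≟ᴹ nothing
      ... | yes e = alt-nothing c e
      ... | no ne = ⊥-elim (nonempty (subst (u ∈_) clear (∈-filter⁺ (switchable? c) u∈ (eq , ne))))
        where
        nonempty : u ∈ [] → ⊥
        nonempty ()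

  -- A neighbour is switchable only for the one colour it has.
  total-switchables : ∀ v c →
    ∑ (L v) (λ x → length (Recolouring.At.switchables x v c)) ≤ length (nbrs v)
  total-switchables v c = begin
    ∑ (L v) (λ x → # (S? x) (nbrs v))          ≡⟨ ∑-#-swap S? (L v) (nbrs v) ⟩
    ∑ (nbrs v) (λ u → # (λ x → S? x u) (L v))  ≤⟨ ∑-mono (nbrs v) (λ {u} _ → #-≤1 (λ x → S? x u) (L-unique v) one) ⟩
    ∑ (nbrs v) (λ _ → 1)                       ≡⟨ sym (length-∑ (nbrs v)) ⟩
    length (nbrs v)                            ∎
    where
    open ≤-Reasoning
    S? = λ x u → Recolouring.At.switchable? x v c u
    one : ∀ {u x y} → Recolouring.At.Switchable x v c u → Recolouring.At.Switchable y v c u → x ≡ y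
    one (e , _) (e′ , _) = just-injective (trans (sym e) e′)

-- The counting induction

-- Adjacency is irreflexive, so a pairwise adjacent list has distinct entries and is already an
-- embedded clique.
cliqueFree : ∀ G {r} → ¬ ContainsK G r → ∀ T → IndependentSets.CliqueFree (adj? G) r T
cliqueFree G {r} free T l refl clique _ = free (List.lookup l , injective , adjacent clique)
  where
  adjacent : ∀ {l} → AllPairs (Adj G) l → ∀ i j → i ≢ j → Adj G (List.lookup l i) (List.lookup l j)
  adjacent (a ∷ cl) zero    zero    ne = ⊥-elim (ne refl)
  adjacent (a ∷ cl) zero    (suc j) ne = All.lookup a (∈-lookup j)
  adjacent (a ∷ cl) (suc i) zero    ne = Graph.sym G (All.lookup a (∈-lookup i))
  adjacent (a ∷ cl) (suc i) (suc j) ne = adjacent cl i j (λ e → ne (cong suc e))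
  injective : ∀ {i j} → List.lookup l i ≡ List.lookup l j → i ≡ j
  injective {i} {j} e with i Fin.≟ j
  ... | yes i≡j = i≡j
  ... | no  i≢j = ⊥-elim (irr G (subst (Adj G _) (sym e) (adjacent clique i j i≢j)))

size : ∀ {m} → Vec Bool m → ℕ
size []          = 0
size (true  ∷ S) = suc (size S)
size (false ∷ S) = size S

size-erase : ∀ {m} (S : Vec Bool m) u → S at u ≡ true → size (S [ u ]≔ false) < size S
size-erase (true  ∷ S) zero    eq = n<1+n (size S)
size-erase (true  ∷ S) (suc u) eq = s≤s (size-erase S u eq)
size-erase (false ∷ S) (suc u) eq = size-erase S u eq

erase-add : ∀ {m} (S : Vec Bool m) u → S at u ≡ true → (S [ u ]≔ false) [ u ]≔ true ≡ S
erase-add S u eq = trans ([]≔-idempotent S u) (trans (cong (S [ u ]≔_) (sym eq)) ([]≔-lookup S u))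

-- N and N′ count the colourings before and after adding a vertex, P sums the clear colourings over
-- all colours, and B counts stuck neighbours.
growth-arithmetic : ∀ q K M N N′ P B Δ ℓ .{{_ : NonZero K}} .{{M≢0 : NonZero M}} .{{_ : NonZero ℓ}} →
  q * (K * N) ≤ K * M * P + Δ * N → P ≤ N′ + B → ℓ * B ≤ Δ * N →
  2 * Δ ≤ q * K → 2 * M * (ℓ * ℓ + Δ) ≤ q * ℓ → ℓ * N ≤ N′
growth-arithmetic q K M N N′ P B Δ ℓ total P≤ stuck qK qℓ = *-cancelˡ-≤ ℓ (+-cancelʳ-≤ (Δ * N) _ _
  (*-cancelˡ-≤ M (*-cancelˡ-≤ 2 (begin
    2 * (M * (ℓ * (ℓ * N) + Δ * N))  ≡⟨ eq₄ M ℓ N Δ ⟩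
    2 * M * (ℓ * ℓ + Δ) * N          ≤⟨ *-monoˡ-≤ N qℓ ⟩
    q * ℓ * N                        ≡⟨ eq₅ q ℓ N ⟩
    ℓ * (q * N)                      ≤⟨ *-monoʳ-≤ ℓ qN ⟩
    ℓ * (2 * (M * P))                ≤⟨ *-monoʳ-≤ ℓ (*-monoʳ-≤ 2 (*-monoʳ-≤ M P≤)) ⟩
    ℓ * (2 * (M * (N′ + B)))         ≡⟨ eq₆ ℓ M N′ B ⟩
    2 * (M * (ℓ * N′ + ℓ * B))       ≤⟨ *-monoʳ-≤ 2 (*-monoʳ-≤ M (+-monoʳ-≤ (ℓ * N′) stuck)) ⟩
    2 * (M * (ℓ * N′ + Δ * N))       ∎))))
  where
  open ≤-Reasoning
  eq₁ : ∀ K q N → K * (q * N) + q * K * N ≡ 2 * (q * (K * N))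
  eq₁ = solve-∀
  eq₂ : ∀ K M P Δ N → 2 * (K * M * P + Δ * N) ≡ K * (2 * (M * P)) + 2 * Δ * N
  eq₂ = solve-∀
  eq₄ : ∀ M ℓ N Δ → 2 * (M * (ℓ * (ℓ * N) + Δ * N)) ≡ 2 * M * (ℓ * ℓ + Δ) * N
  eq₄ = solve-∀
  eq₅ : ∀ q ℓ N → q * ℓ * N ≡ ℓ * (q * N)
  eq₅ = solve-∀
  eq₆ : ∀ ℓ M N′ B → ℓ * (2 * (M * (N′ + B))) ≡ 2 * (M * (ℓ * N′ + ℓ * B))
  eq₆ = solve-∀
  -- As 2Δ ≤ q K, the term `Δ * N` is at most half of `q * (K * N)`, which leaves the other half to
  -- the clear colourings.
  qN : q * N ≤ 2 * (M * P)
  qN = *-cancelˡ-≤ K (+-cancelʳ-≤ (q * K * N) _ _ (begin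
    K * (q * N) + q * K * N        ≡⟨ eq₁ K q N ⟩
    2 * (q * (K * N))              ≤⟨ *-monoʳ-≤ 2 total ⟩
    2 * (K * M * P + Δ * N)        ≡⟨ eq₂ K M P Δ N ⟩
    K * (2 * (M * P)) + 2 * Δ * N  ≤⟨ +-monoʳ-≤ (K * (2 * (M * P))) (*-monoˡ-≤ N qK) ⟩
    K * (2 * (M * P)) + q * K * N  ∎))

module Existence (G : Graph) (L : Fin (n G) → List ℕ) (L-unique : ∀ v → Unique (L v)) where

  open IndependentSets (adj? G)
  open Colourings G L L-unique
  open IsColouring
  open Counting G L L-unique

  nonempty : (∀ S v → S at v ≡ false → length (cols S) ≤ length (cols (S [ v ]≔ true))) →
    ∀ m S → size S < m → 1 ≤ length (cols S)
  nonempty grow (suc m) S lt with any? (λ u → (S at u) ≟ᵇ true)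
  ... | yes (u , eq) = begin
    1                                             ≤⟨ nonempty grow m (S [ u ]≔ false) (<-≤-trans (size-erase S u eq) (≤-pred lt)) ⟩
    length (cols (S [ u ]≔ false))                ≤⟨ grow (S [ u ]≔ false) u (lookup∘update u S false) ⟩
    length (cols ((S [ u ]≔ false) [ u ]≔ true))  ≡⟨ cong (λ S → length (cols S)) (erase-add S u eq) ⟩
    length (cols S)                               ∎
    where open ≤-Reasoning
  ... | no none = length-⊆ {zs = blank ∷ []} ([] ∷ []) λ { (here refl) → ∈-cols⁺ S (isColouring ch pr) }
    where
    blank : Colouring
    blank = replicate (n G) nothing
    false! : ∀ u → S at u ≡ false
    false! u with S at u in eq
    ... | false = refl
    ... | true  = ⊥-elim (none (u , eq))
    ch : ∀ u → blank at u ∈ choices (S at u) u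
    ch u = subst (λ b → blank at u ∈ choices b u) (sym (false! u)) (here (lookup-replicate u nothing))
    pr : Proper blank
    pr u w a eq = lookup-replicate u nothing

  list-colouring : (∀ S v → S at v ≡ false → length (cols S) ≤ length (cols (S [ v ]≔ true))) →
    ∃ λ (f : Vertex → ℕ) → (∀ v → f v ∈ L v) × (∀ u v → Adj G u v → f u ≢ f v)
  list-colouring grow with cols full in e | nonempty grow (suc (size full)) full ≤-refl
    where full = replicate (n G) true
  ... | c ∷ _ | _ = (λ v → proj₁ (value v)) , (λ v → colour∈L isC (proj₂ (value v))) ,
    λ u v a eq → absurd (proj₂ (value u))
      (proper isC u v a (trans (proj₂ (value u)) (trans (cong just eq) (sym (proj₂ (value v))))))
    where
    isC = ∈-cols⁻ (replicate (n G) true) (subst (c ∈_) (sym e) (here refl))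
    value : ∀ v → ∃ λ x → c at v ≡ just x
    value v = true⇒coloured isC (lookup-replicate v true)
    absurd : ∀ {a : Maybe ℕ} {x} → a ≡ just x → a ≢ nothing
    absurd refl ()
  list-colouring grow | [] | ()

  length-L≤ : ∀ c v → length (L v) ≤ length (avail c v) + length (nbrs v)
  length-L≤ c v = begin
    length (L v)                                           ≡⟨ sym (length-map just (L v)) ⟩
    length (map just (L v))                                ≤⟨ length-⊆ (Unique.map⁺ just-injective (L-unique v)) sub ⟩
    length (map just (avail c v) ++ map (c at_) (nbrs v))  ≡⟨ length-++ (map just (avail c v)) ⟩
    length (map just (avail c v)) + length (map (c at_) (nbrs v))
      ≡⟨ cong₂ _+_ (length-map just (avail c v)) (length-map (c at_) (nbrs v)) ⟩
    length (avail c v) + length (nbrs v)                 ∎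
    where
    open ≤-Reasoning
    open DecMembership _≟ᴹ_ using (_∈?_)
    sub : ∀ {a} → a ∈ map just (L v) → a ∈ map just (avail c v) ++ map (c at_) (nbrs v)
    sub {a} a∈ with ∈-map⁻ just a∈
    ... | x , x∈ , refl with just x ∈? map (c at_) (nbrs v)
    ...   | yes used = ∈-++⁺ʳ (map just (avail c v)) used
    ...   | no  free = ∈-++⁺ˡ (∈-map⁺ just (∈-avail⁺ c x∈ λ w adj eq →
              free (subst (_∈ map (c at_) (nbrs v)) eq (∈-map⁺ (c at_) (∈-nbrs⁺ adj)))))

  greedy-grow : ∀ {Δ} → (∀ v → length (L v) ≡ suc Δ) → (∀ v → degree G v ≤ Δ) →
    ∀ S v → S at v ≡ false → length (cols S) ≤ length (cols (S [ v ]≔ true))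
  greedy-grow {Δ} len deg S v v∉ = begin
    length (cols S)                        ≡⟨ length-∑ (cols S) ⟩
    ∑ (cols S) (λ _ → 1)                   ≤⟨ ∑-mono (cols S) (λ {c} _ → some c) ⟩
    ∑ (cols S) (λ c → length (avail c v))  ≤⟨ count-extensions S v∉ ⟩
    length (cols (S [ v ]≔ true))          ∎
    where
    open ≤-Reasoning
    some : ∀ c → 1 ≤ length (avail c v)
    some c = +-cancelʳ-≤ Δ 1 (length (avail c v)) (begin
      suc Δ                                 ≡⟨ sym (len v) ⟩
      length (L v)                          ≤⟨ length-L≤ c v ⟩
      length (avail c v) + length (nbrs v)  ≤⟨ +-monoʳ-≤ (length (avail c v)) (deg v) ⟩
      length (avail c v) + Δ                ∎)

  module Rosenfeld {q Δ ℓ K p r : ℕ} .{{_ : NonZero K}} .{{_ : NonZero ℓ}}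
    (len : ∀ v → length (L v) ≡ q) (deg : ∀ v → degree G v ≤ Δ)
    (cf : ∀ T → CliqueFree (suc r) T)
    (growth : ∀ j → p ≤ j → 2 * suc j ^ (r * (2 * K)) ≤ 2 ^ j)
    (qK : 2 * Δ ≤ q * K) (qℓ : 2 * 2 ^ p * (ℓ * ℓ + Δ) ≤ q * ℓ) where

    module _ S {v} (v∉ : S at v ≡ false)
      (ih : ∀ u → S at u ≡ true → ℓ * length (cols (S [ u ]≔ false)) ≤ length (cols S)) where

      open ≤-Reasoning

      private
        N = length (cols S)
        clears : ℕ → ℕ
        clears x = # (Fibres.clear? x v) (cols S)
        stuck : ℕ
        stuck = ∑ (nbrs v) (λ u → # (λ c → stuck? c u) (cols S))
        switch : ℕ → Colouring → ℕ
        switch x c = length (Recolouring.At.switchables x v c)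

      total : q * (K * N) ≤ K * 2 ^ p * ∑ (L v) clears + Δ * N
      total = begin
        q * (K * N)
          ≡⟨ cong (_* (K * N)) (sym (len v)) ⟩
        length (L v) * (K * N)
          ≡⟨ sym (∑-const (L v) (K * N)) ⟩
        ∑ (L v) (λ _ → K * N)
          ≤⟨ ∑-mono (L v) (λ {x} _ → Fibres.fibre-count x v S K (2 ^ p) λ {c} _ →
               mean-independent-size K p r growth
                 (Unique.filter⁺ (Recolouring.At.switched? x v c) (nbrs-unique v)) (cf _)) ⟩
        ∑ (L v) (λ x → K * 2 ^ p * clears x + ∑ (cols S) (switch x))
          ≡⟨ ∑-distrib-+ (L v) _ _ ⟩
        ∑ (L v) (λ x → K * 2 ^ p * clears x) + ∑ (L v) (λ x → ∑ (cols S) (switch x))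
          ≡⟨ cong₂ _+_ (∑-distribˡ-* (K * 2 ^ p) (L v) clears) (∑-swap (L v) (cols S) switch) ⟩
        K * 2 ^ p * ∑ (L v) clears + ∑ (cols S) (λ c → ∑ (L v) (λ x → switch x c))
          ≤⟨ +-monoʳ-≤ (K * 2 ^ p * ∑ (L v) clears) (∑-mono (cols S) λ {c} _ → ≤-trans (total-switchables v c) (deg v)) ⟩
        K * 2 ^ p * ∑ (L v) clears + ∑ (cols S) (λ _ → Δ)
          ≡⟨ cong (K * 2 ^ p * ∑ (L v) clears +_) (trans (∑-const (cols S) Δ) (*-comm N Δ)) ⟩
        K * 2 ^ p * ∑ (L v) clears + Δ * N ∎

      clears≤ : ∑ (L v) clears ≤ length (cols (S [ v ]≔ true)) + stuck
      clears≤ = begin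
        ∑ (L v) clears
          ≡⟨ ∑-#-swap (λ x c → Fibres.clear? x v c) (L v) (cols S) ⟩
        ∑ (cols S) (λ c → # (λ x → Fibres.clear? x v c) (L v))
          ≤⟨ ∑-mono (cols S) (λ c∈ → clear≤avail+stuck v (∈-cols⁻ S c∈)) ⟩
        ∑ (cols S) (λ c → length (avail c v) + # (stuck? c) (nbrs v))
          ≡⟨ ∑-distrib-+ (cols S) _ _ ⟩
        ∑ (cols S) (λ c → length (avail c v)) + ∑ (cols S) (λ c → # (stuck? c) (nbrs v))
          ≤⟨ +-mono-≤ (count-extensions S v∉) (≤-reflexive (∑-#-swap stuck? (cols S) (nbrs v))) ⟩
        length (cols (S [ v ]≔ true)) + stuck ∎

      stuck≤ : ℓ * stuck ≤ Δ * N
      stuck≤ = begin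
        ℓ * stuck                                             ≡⟨ sym (∑-distribˡ-* ℓ (nbrs v) _) ⟩
        ∑ (nbrs v) (λ u → ℓ * # (λ c → stuck? c u) (cols S))  ≤⟨ ∑-mono (nbrs v) (λ {u} _ → one u) ⟩
        ∑ (nbrs v) (λ _ → N)                                  ≡⟨ ∑-const (nbrs v) N ⟩
        length (nbrs v) * N                                   ≤⟨ *-monoˡ-≤ N (deg v) ⟩
        Δ * N                                                 ∎
        where
        one : ∀ u → ℓ * # (λ c → stuck? c u) (cols S) ≤ N
        one u with S at u in eq
        ... | true  = ≤-trans (*-monoʳ-≤ ℓ (count-stuck S eq)) (ih u eq)
        ... | false = ≤-trans (≤-reflexive (trans (cong (ℓ *_)
                (#-none (λ c → stuck? c u) (cols S) λ c∈ s → proj₁ s (false⇒uncoloured (∈-cols⁻ S c∈) eq)))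
                (*-zeroʳ ℓ))) z≤n

      step : ℓ * N ≤ length (cols (S [ v ]≔ true))
      step = growth-arithmetic q K (2 ^ p) N (length (cols (S [ v ]≔ true))) (∑ (L v) clears) stuck Δ ℓ
        {{M≢0 = m^n≢0 2 p}} total clears≤ stuck≤ qK qℓ

    -- Nonemptiness alone would not pass through the induction: the factor `ℓ` for smaller sets is
    -- what bounds the stuck neighbours.
    grow : ∀ m S v → size S < m → S at v ≡ false → ℓ * length (cols S) ≤ length (cols (S [ v ]≔ true))
    grow (suc m) S v lt v∉ = step S v∉ λ u eq →
      subst (λ T → ℓ * length (cols (S [ u ]≔ false)) ≤ length (cols T)) (erase-add S u eq)
        (grow m (S [ u ]≔ false) u (<-≤-trans (size-erase S u eq) (≤-pred lt)) (lookup∘update u S false))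

    rosenfeld-grow : ∀ S v → S at v ≡ false → length (cols S) ≤ length (cols (S [ v ]≔ true))
    rosenfeld-grow S v v∉ = ≤-trans (m≤n*m (length (cols S)) ℓ) (grow (suc (size S)) S v ≤-refl v∉)

greedy-choosable : ∀ G {Δ} → (∀ v → degree G v ≤ Δ) → Choosable G (suc Δ)
greedy-choosable G deg (L , h) = list-colouring (greedy-grow (λ v → proj₂ (h v)) deg)
  where open Existence G L (λ v → proj₁ (h v))

cliqueFree-choosable : ∀ G {q Δ ℓ K p r} .{{_ : NonZero K}} .{{_ : NonZero ℓ}} →
  ¬ ContainsK G (suc r) → (∀ v → degree G v ≤ Δ) →
  (∀ j → p ≤ j → 2 * suc j ^ (r * (2 * K)) ≤ 2 ^ j) →
  2 * Δ ≤ q * K → 2 * 2 ^ p * (ℓ * ℓ + Δ) ≤ q * ℓ → Choosable G q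
cliqueFree-choosable G {ℓ = ℓ} {K} {p} {r} free deg growth qK qℓ (L , h) = list-colouring
  (Rosenfeld.rosenfeld-grow {ℓ = ℓ} {K} {p} {r} (λ v → proj₂ (h v)) deg (cliqueFree G free) growth qK qℓ)
  where open Existence G L (λ v → proj₁ (h v))

-- The exponential series

module ExponentialBounds where

  open ℚ.≤-Reasoning
  open +-*-Solver using (solve; _:=_; _:+_; _:*_; con)

  -- Opaque copies of the embedding of ℕ and of 1/(k+1): unfolding them exposes gcd computations.
  abstract
    ι : ℕ → ℚ
    ι = fromℕℚ

    recip : ℕ → ℚ
    recip k = ℤ.+ 1 ℚ./ suc k

    ι≡fromℕ : ∀ a → ι a ≡ fromℕℚ a
    ι≡fromℕ a = refl

    ι-0 : ι 0 ≡ 0ℚ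
    ι-0 = refl

    ι-1 : ι 1 ≡ 1ℚ
    ι-1 = refl

    recip-0 : recip 0 ≡ 1ℚ
    recip-0 = refl

    ι-* : ∀ a b → ι (a * b) ≡ ι a ℚ.* ι b
    ι-* a b = ℚ.toℚᵘ-injective (ℚᵘ.≃-trans (ℚ.toℚᵘ-fromℚᵘ (ℚᵘ.mkℚᵘ (ℤ.+ (a * b)) 0))
      (ℚᵘ.≃-sym (ℚᵘ.≃-trans (ℚ.toℚᵘ-homo-* (ι a) (ι b))
        (ℚᵘ.≃-trans (ℚᵘ.*-cong (ℚ.toℚᵘ-fromℚᵘ (ℚᵘ.mkℚᵘ (ℤ.+ a) 0)) (ℚ.toℚᵘ-fromℚᵘ (ℚᵘ.mkℚᵘ (ℤ.+ b) 0)))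
          (ℚᵘ.*≡* (cong (ℤ._* ℤ.+ 1) (sym (ℤ.pos-* a b))))))))

    ι-suc : ∀ a → ι (suc a) ≡ 1ℚ ℚ.+ ι a
    ι-suc a = ℚ.toℚᵘ-injective (ℚᵘ.≃-trans (ℚ.toℚᵘ-fromℚᵘ (ℚᵘ.mkℚᵘ (ℤ.+ suc a) 0))
      (ℚᵘ.≃-sym (ℚᵘ.≃-trans (ℚ.toℚᵘ-homo-+ 1ℚ (ι a))
        (ℚᵘ.≃-trans (ℚᵘ.+-congʳ ℚᵘ.1ℚᵘ (ℚ.toℚᵘ-fromℚᵘ (ℚᵘ.mkℚᵘ (ℤ.+ a) 0)))
          (ℚᵘ.*≡* (cong (ℤ._* ℤ.+ 1) (cong (λ z → ℤ.1ℤ ℤ.+ z) (ℤ.*-identityʳ (ℤ.+ a)))))))))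

    ι-mono : ∀ {a b} → a ≤ b → ι a ℚ.≤ ι b
    ι-mono {a} {b} a≤b = ℚ.toℚᵘ-cancel-≤ (ℚᵘ.≤-respʳ-≃ (ℚᵘ.≃-sym (ℚ.toℚᵘ-fromℚᵘ (ℚᵘ.mkℚᵘ (ℤ.+ b) 0)))
      (ℚᵘ.≤-respˡ-≃ (ℚᵘ.≃-sym (ℚ.toℚᵘ-fromℚᵘ (ℚᵘ.mkℚᵘ (ℤ.+ a) 0)))
        (ℚᵘ.*≤* (ℤ.*-monoʳ-≤-nonNeg (ℤ.+ 1) (ℤ.+≤+ a≤b)))))

    suc*recip : ∀ k → ι (suc k) ℚ.* recip k ≡ 1ℚ
    suc*recip k = ℚ.toℚᵘ-injective (ℚᵘ.≃-trans (ℚ.toℚᵘ-homo-* (ι (suc k)) (recip k))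
      (ℚᵘ.≃-trans (ℚᵘ.*-cong (ℚ.toℚᵘ-fromℚᵘ (ℚᵘ.mkℚᵘ (ℤ.+ suc k) 0)) (ℚ.toℚᵘ-fromℚᵘ (ℚᵘ.mkℚᵘ (ℤ.+ 1) k)))
        (ℚᵘ.*≡* (trans (ℤ.*-identityʳ _) (trans (ℤ.*-identityʳ (ℤ.+ suc k))
          (sym (trans (ℤ.*-identityˡ _) (ℤ.*-identityˡ (ℤ.+ suc k)))))))))

  -- A copy of `expTerm` over the opaque `recip`; the two are identified once, in an `abstract`
  -- block where `recip` unfolds.
  term : ℚ → ℕ → ℚ
  term y zero    = 1ℚ
  term y (suc j) = term y j ℚ.* (y ℚ.* recip j)

  series : ℚ → ℕ → ℚ
  series y zero    = 0ℚ
  series y (suc m) = series y m ℚ.+ term y m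

  abstract
    expTerm≡term : ∀ y j → expTerm y j ≡ term y j
    expTerm≡term y zero    = refl
    expTerm≡term y (suc j) = cong (λ t → t ℚ.* (y ℚ.* recip j)) (expTerm≡term y j)

  expPartial≡series : ∀ y m → expPartial y m ≡ series y m
  expPartial≡series y zero    = refl
  expPartial≡series y (suc m) = cong₂ ℚ._+_ (expPartial≡series y m) (expTerm≡term y m)

  ι≥0 : ∀ a → 0ℚ ℚ.≤ ι a
  ι≥0 a = subst (ℚ._≤ ι a) ι-0 (ι-mono ℕ.z≤n)

  ι>0 : ∀ a .{{_ : NonZero a}} → 0ℚ ℚ.< ι a
  ι>0 a = ℚ.<-≤-trans (ℚ.positive⁻¹ 1ℚ) (subst (ℚ._≤ ι a) ι-1 (ι-mono (ℕ.>-nonZero⁻¹ a)))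

  0≤1 : 0ℚ ℚ.≤ 1ℚ
  0≤1 = ℚ.nonNegative⁻¹ 1ℚ

  *-monoˡ : ∀ {r p q} → 0ℚ ℚ.≤ r → p ℚ.≤ q → r ℚ.* p ℚ.≤ r ℚ.* q
  *-monoˡ {r} r≥0 = ℚ.*-monoˡ-≤-nonNeg r {{ℚ.nonNegative r≥0}}

  *-monoʳ : ∀ {r p q} → 0ℚ ℚ.≤ r → p ℚ.≤ q → p ℚ.* r ℚ.≤ q ℚ.* r
  *-monoʳ {r} r≥0 = ℚ.*-monoʳ-≤-nonNeg r {{ℚ.nonNegative r≥0}}

  *-mono : ∀ {p q r s} → 0ℚ ℚ.≤ p → 0ℚ ℚ.≤ s → p ℚ.≤ q → r ℚ.≤ s → p ℚ.* r ℚ.≤ q ℚ.* s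
  *-mono p≥0 s≥0 p≤q r≤s = ℚ.≤-trans (*-monoˡ p≥0 r≤s) (*-monoʳ s≥0 p≤q)

  *≥0 : ∀ {p q} → 0ℚ ℚ.≤ p → 0ℚ ℚ.≤ q → 0ℚ ℚ.≤ p ℚ.* q
  *≥0 {p} {q} p≥0 q≥0 = subst (ℚ._≤ p ℚ.* q) (ℚ.*-zeroʳ p) (*-monoˡ p≥0 q≥0)

  cancelʳ : ∀ {r p q} → 0ℚ ℚ.< r → p ℚ.* r ℚ.≤ q ℚ.* r → p ℚ.≤ q
  cancelʳ {r} r>0 = ℚ.*-cancelʳ-≤-pos r {{ℚ.positive r>0}}

  recip≥0 : ∀ k → 0ℚ ℚ.≤ recip k
  recip≥0 k = cancelʳ (ι>0 (suc k)) (begin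
    0ℚ ℚ.* ι (suc k)       ≡⟨ ℚ.*-zeroˡ (ι (suc k)) ⟩
    0ℚ                     ≤⟨ 0≤1 ⟩
    1ℚ                     ≡⟨ sym (suc*recip k) ⟩
    ι (suc k) ℚ.* recip k  ≡⟨ ℚ.*-comm (ι (suc k)) (recip k) ⟩
    recip k ℚ.* ι (suc k)  ∎)

  term≥0 : ∀ {y} j → 0ℚ ℚ.≤ y → 0ℚ ℚ.≤ term y j
  term≥0 zero    y≥0 = 0≤1
  term≥0 (suc j) y≥0 = *≥0 (term≥0 j y≥0) (*≥0 y≥0 (recip≥0 j))

  term-mono : ∀ {y z} j → 0ℚ ℚ.≤ y → y ℚ.≤ z → term y j ℚ.≤ term z j
  term-mono zero    y≥0 y≤z = ℚ.≤-refl
  term-mono (suc j) y≥0 y≤z = *-mono (term≥0 j y≥0) (*≥0 (ℚ.≤-trans y≥0 y≤z) (recip≥0 j))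
    (term-mono j y≥0 y≤z) (*-monoʳ (recip≥0 j) y≤z)

  series-mono : ∀ {y z} m → 0ℚ ℚ.≤ y → y ℚ.≤ z → series y m ℚ.≤ series z m
  series-mono zero    y≥0 y≤z = ℚ.≤-refl
  series-mono (suc m) y≥0 y≤z = ℚ.+-mono-≤ (series-mono m y≥0 y≤z) (term-mono m y≥0 y≤z)

  series-suc : ∀ {y} m → 0ℚ ℚ.≤ y → series y m ℚ.≤ series y (suc m)
  series-suc {y} m y≥0 = begin
    series y m         ≡⟨ sym (ℚ.+-identityʳ (series y m)) ⟩
    series y m ℚ.+ 0ℚ  ≤⟨ ℚ.+-monoʳ-≤ (series y m) (term≥0 m y≥0) ⟩
    series y (suc m)   ∎

  term-suc : ∀ y j → term y j ℚ.* y ≡ ι (suc j) ℚ.* term y (suc j)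
  term-suc y j = begin-equality
    t ℚ.* y                                ≡⟨ sym (ℚ.*-identityˡ (t ℚ.* y)) ⟩
    1ℚ ℚ.* (t ℚ.* y)                       ≡⟨ cong (ℚ._* (t ℚ.* y)) (sym (suc*recip j)) ⟩
    ι (suc j) ℚ.* recip j ℚ.* (t ℚ.* y)    ≡⟨ eq (ι (suc j)) (recip j) t y ⟩
    ι (suc j) ℚ.* (t ℚ.* (y ℚ.* recip j))  ∎
    where
    t = term y j
    eq : ∀ s g t y → s ℚ.* g ℚ.* (t ℚ.* y) ≡ s ℚ.* (t ℚ.* (y ℚ.* g))
    eq = solve 4 (λ s g t y → s :* g :* (t :* y) := s :* (t :* (y :* g))) refl

  module _ {b h : ℚ} (b≥0 : 0ℚ ℚ.≤ b) (h≥0 : 0ℚ ℚ.≤ h) where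

    private
      a : ℚ
      a = b ℚ.+ h
      b≤a : b ℚ.≤ a
      b≤a = subst (ℚ._≤ a) (ℚ.+-identityʳ b) (ℚ.+-monoʳ-≤ b h≥0)
      a≥0 : 0ℚ ℚ.≤ a
      a≥0 = ℚ.≤-trans b≥0 b≤a

    -- (b + h)^(j+1) ≤ b^(j+1) + (j+1) h (b + h)^j, divided by (j+1)!
    term-shift : ∀ j → term a (suc j) ℚ.≤ term b (suc j) ℚ.+ h ℚ.* term a j
    term-shift zero = ℚ.≤-reflexive (eq b h (recip 0) recip-0)
      where
      eq : ∀ b h g → g ≡ 1ℚ → 1ℚ ℚ.* ((b ℚ.+ h) ℚ.* g) ≡ 1ℚ ℚ.* (b ℚ.* g) ℚ.+ h ℚ.* 1ℚ
      eq b h g refl = solve 2 (λ b h → con 1ℚ :* ((b :+ h) :* con 1ℚ) := con 1ℚ :* (b :* con 1ℚ) :+ h :* con 1ℚ) refl b h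
    term-shift (suc j) = begin
      t₁ ℚ.* ((b ℚ.+ h) ℚ.* g)
        ≡⟨ eq₁ t₁ b h g ⟩
      t₁ ℚ.* (b ℚ.* g) ℚ.+ t₁ ℚ.* (h ℚ.* g)
        ≤⟨ ℚ.+-monoˡ-≤ (t₁ ℚ.* (h ℚ.* g)) (*-monoʳ (*≥0 b≥0 (recip≥0 (suc j))) (term-shift j)) ⟩
      (s₁ ℚ.+ h ℚ.* t₀) ℚ.* (b ℚ.* g) ℚ.+ t₁ ℚ.* (h ℚ.* g)
        ≡⟨ eq₂ s₁ h t₀ b g t₁ ⟩
      s₁ ℚ.* (b ℚ.* g) ℚ.+ h ℚ.* g ℚ.* (t₀ ℚ.* b ℚ.+ t₁)
        -- Raising `b` to `a` turns the bracket into (j + 2) `t₁`, which cancels against `g` = 1/(j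
        -- + 2).
        ≤⟨ ℚ.+-monoʳ-≤ (s₁ ℚ.* (b ℚ.* g)) (*-monoˡ (*≥0 h≥0 (recip≥0 (suc j))) (ℚ.+-monoˡ-≤ t₁ (*-monoˡ (term≥0 j a≥0) b≤a))) ⟩
      s₁ ℚ.* (b ℚ.* g) ℚ.+ h ℚ.* g ℚ.* (t₀ ℚ.* a ℚ.+ t₁)
        ≡⟨ cong (λ z → s₁ ℚ.* (b ℚ.* g) ℚ.+ h ℚ.* g ℚ.* (z ℚ.+ t₁)) (term-suc a j) ⟩
      s₁ ℚ.* (b ℚ.* g) ℚ.+ h ℚ.* g ℚ.* (ι (suc j) ℚ.* t₁ ℚ.+ t₁)
        ≡⟨ eq₃ (s₁ ℚ.* (b ℚ.* g)) h g (ι (suc j)) t₁ ⟩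
      s₁ ℚ.* (b ℚ.* g) ℚ.+ h ℚ.* ((1ℚ ℚ.+ ι (suc j)) ℚ.* g ℚ.* t₁)
        ≡⟨ cong (λ z → s₁ ℚ.* (b ℚ.* g) ℚ.+ h ℚ.* (z ℚ.* t₁))
             (trans (cong (ℚ._* g) (sym (ι-suc (suc j)))) (suc*recip (suc j))) ⟩
      s₁ ℚ.* (b ℚ.* g) ℚ.+ h ℚ.* (1ℚ ℚ.* t₁)
        ≡⟨ cong (λ z → s₁ ℚ.* (b ℚ.* g) ℚ.+ h ℚ.* z) (ℚ.*-identityˡ t₁) ⟩
      s₁ ℚ.* (b ℚ.* g) ℚ.+ h ℚ.* t₁ ∎
      where
      g  = recip (suc j)
      t₀ = term a j
      t₁ = term a (suc j)
      s₁ = term b (suc j)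
      eq₁ : ∀ t b h g → t ℚ.* ((b ℚ.+ h) ℚ.* g) ≡ t ℚ.* (b ℚ.* g) ℚ.+ t ℚ.* (h ℚ.* g)
      eq₁ = solve 4 (λ t b h g → t :* ((b :+ h) :* g) := t :* (b :* g) :+ t :* (h :* g)) refl
      eq₂ : ∀ s h t b g u → (s ℚ.+ h ℚ.* t) ℚ.* (b ℚ.* g) ℚ.+ u ℚ.* (h ℚ.* g) ≡ s ℚ.* (b ℚ.* g) ℚ.+ h ℚ.* g ℚ.* (t ℚ.* b ℚ.+ u)
      eq₂ = solve 6 (λ s h t b g u → (s :+ h :* t) :* (b :* g) :+ u :* (h :* g) := s :* (b :* g) :+ h :* g :* (t :* b :+ u)) refl
      eq₃ : ∀ x h g n t → x ℚ.+ h ℚ.* g ℚ.* (n ℚ.* t ℚ.+ t) ≡ x ℚ.+ h ℚ.* ((1ℚ ℚ.+ n) ℚ.* g ℚ.* t)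
      eq₃ = solve 5 (λ x h g n t → x :+ h :* g :* (n :* t :+ t) := x :+ h :* ((con 1ℚ :+ n) :* g :* t)) refl

    -- The partial-sum form of exp(b + h) ≤ exp(b) + h exp(b + h); the factor `h` lowers the degree
    -- by one, hence the shorter series on the right.
    series-shift : ∀ m → series a (suc m) ℚ.≤ series b (suc m) ℚ.+ h ℚ.* series a m
    series-shift zero = ℚ.≤-reflexive (sym (trans (cong (series b 1 ℚ.+_) (ℚ.*-zeroʳ h)) refl))
    series-shift (suc m) = begin
      series a (suc m) ℚ.+ term a (suc m)
        ≤⟨ ℚ.+-mono-≤ (series-shift m) (term-shift m) ⟩
      series b (suc m) ℚ.+ h ℚ.* series a m ℚ.+ (term b (suc m) ℚ.+ h ℚ.* term a m)
        ≡⟨ eq (series b (suc m)) h (series a m) (term b (suc m)) (term a m) ⟩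
      series b (suc m) ℚ.+ term b (suc m) ℚ.+ h ℚ.* (series a m ℚ.+ term a m) ∎
      where
      eq : ∀ x h y s t → x ℚ.+ h ℚ.* y ℚ.+ (s ℚ.+ h ℚ.* t) ≡ x ℚ.+ s ℚ.+ h ℚ.* (y ℚ.+ t)
      eq = solve 5 (λ x h y s t → x :+ h :* y :+ (s :+ h :* t) := x :+ s :+ h :* (y :+ t)) refl

  series-0 : ∀ m → series 0ℚ m ℚ.≤ 1ℚ
  series-0 zero          = 0≤1
  series-0 (suc zero)    = ℚ.≤-refl
  series-0 (suc (suc m)) = begin
    series 0ℚ (suc m) ℚ.+ term 0ℚ m ℚ.* (0ℚ ℚ.* recip m)
      ≡⟨ cong (λ z → series 0ℚ (suc m) ℚ.+ z) (trans (cong (term 0ℚ m ℚ.*_) (ℚ.*-zeroˡ (recip m))) (ℚ.*-zeroʳ (term 0ℚ m))) ⟩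
    series 0ℚ (suc m) ℚ.+ 0ℚ  ≡⟨ ℚ.+-identityʳ (series 0ℚ (suc m)) ⟩
    series 0ℚ (suc m)         ≤⟨ series-0 (suc m) ⟩
    1ℚ                        ∎

  grid : ℕ → ℕ → ℚ
  grid k N = ι N ℚ.* recip k

  grid≥0 : ∀ k N → 0ℚ ℚ.≤ grid k N
  grid≥0 k N = *≥0 (ι≥0 N) (recip≥0 k)

  grid-suc : ∀ k N → grid k (suc N) ≡ grid k N ℚ.+ recip k
  grid-suc k N = trans (cong (ℚ._* recip k) (ι-suc N))
    (solve 2 (λ n g → (con 1ℚ :+ n) :* g := n :* g :+ g) refl (ι N) (recip k))

  -- exp(1/(k+1)) ≤ (k+1)/k, in cleared form.
  exp-step : ∀ k N m → ι k ℚ.* series (grid k (suc N)) m ℚ.≤ ι (suc k) ℚ.* series (grid k N) m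
  exp-step k N zero    = ℚ.≤-reflexive (trans (ℚ.*-zeroʳ (ι k)) (sym (ℚ.*-zeroʳ (ι (suc k)))))
  -- Multiplied by k + 1, `series-shift` with h = 1/(k + 1) reads (k + 1) eₐ ≤ (k + 1) eᵦ + eₐ;
  -- cancelling eₐ leaves the claim.
  exp-step k N (suc m) = subst (λ y → ι k ℚ.* series y (suc m) ℚ.≤ s ℚ.* eᵦ) (sym (grid-suc k N)) (cancel {k′ ℚ.* eₐ} {s ℚ.* eᵦ} {eₐ} (begin
    k′ ℚ.* eₐ ℚ.+ eₐ                 ≡⟨ eq₁ k′ eₐ ⟩
    (1ℚ ℚ.+ k′) ℚ.* eₐ               ≡⟨ cong (ℚ._* eₐ) (sym (ι-suc k)) ⟩
    s ℚ.* eₐ                         ≤⟨ *-monoˡ (ι≥0 (suc k)) (series-shift (grid≥0 k N) (recip≥0 k) m) ⟩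
    s ℚ.* (eᵦ ℚ.+ g ℚ.* series a m)  ≤⟨ *-monoˡ (ι≥0 (suc k)) (ℚ.+-monoʳ-≤ eᵦ (*-monoˡ (recip≥0 k) (series-suc m a≥0))) ⟩
    s ℚ.* (eᵦ ℚ.+ g ℚ.* eₐ)          ≡⟨ eq₂ s eᵦ g eₐ ⟩
    s ℚ.* eᵦ ℚ.+ s ℚ.* g ℚ.* eₐ      ≡⟨ cong (λ z → s ℚ.* eᵦ ℚ.+ z ℚ.* eₐ) (suc*recip k) ⟩
    s ℚ.* eᵦ ℚ.+ 1ℚ ℚ.* eₐ           ≡⟨ cong (s ℚ.* eᵦ ℚ.+_) (ℚ.*-identityˡ eₐ) ⟩
    s ℚ.* eᵦ ℚ.+ eₐ                  ∎))
    where
    k′ = ι k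
    s  = ι (suc k)
    g  = recip k
    a  = grid k N ℚ.+ g
    eₐ  = series a (suc m)
    eᵦ  = series (grid k N) (suc m)
    a≥0 : 0ℚ ℚ.≤ a
    a≥0 = ℚ.+-mono-≤ (grid≥0 k N) (recip≥0 k)
    eq₁ : ∀ k eₐ → k ℚ.* eₐ ℚ.+ eₐ ≡ (1ℚ ℚ.+ k) ℚ.* eₐ
    eq₁ = solve 2 (λ k eₐ → k :* eₐ :+ eₐ := (con 1ℚ :+ k) :* eₐ) refl
    eq₂ : ∀ s eᵦ g eₐ → s ℚ.* (eᵦ ℚ.+ g ℚ.* eₐ) ≡ s ℚ.* eᵦ ℚ.+ s ℚ.* g ℚ.* eₐ
    eq₂ = solve 4 (λ s eᵦ g eₐ → s :* (eᵦ :+ g :* eₐ) := s :* eᵦ :+ s :* g :* eₐ) refl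
    cancel : ∀ {x y z} → x ℚ.+ z ℚ.≤ y ℚ.+ z → x ℚ.≤ y
    cancel {x} {y} {z} h = begin
      x                    ≡⟨ eq x z ⟩
      x ℚ.+ z ℚ.+ (ℚ.- z)  ≤⟨ ℚ.+-monoˡ-≤ (ℚ.- z) h ⟩
      y ℚ.+ z ℚ.+ (ℚ.- z)  ≡⟨ sym (eq y z) ⟩
      y                    ∎
      where
      eq : ∀ x z → x ≡ x ℚ.+ z ℚ.+ (ℚ.- z)
      eq x z = sym (trans (ℚ.+-assoc x z (ℚ.- z)) (trans (cong (x ℚ.+_) (ℚ.+-inverseʳ z)) (ℚ.+-identityʳ x)))

  -- `N` steps of length 1/(k + 1), starting from exp(0) = 1.
  exp-grid : ∀ k N m → ι (k ^ N) ℚ.* series (grid k N) m ℚ.≤ ι (suc k ^ N)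
  exp-grid k zero m = begin
    ι 1 ℚ.* series (grid k 0) m  ≡⟨ cong₂ ℚ._*_ ι-1 (cong (λ y → series y m) (trans (cong (ℚ._* recip k) ι-0) (ℚ.*-zeroˡ (recip k)))) ⟩
    1ℚ ℚ.* series 0ℚ m           ≡⟨ ℚ.*-identityˡ (series 0ℚ m) ⟩
    series 0ℚ m                  ≤⟨ series-0 m ⟩
    1ℚ                           ≡⟨ sym ι-1 ⟩
    ι 1                          ∎
  exp-grid k (suc N) m = begin
    ι (k * k ^ N) ℚ.* series (grid k (suc N)) m
      ≡⟨ trans (cong (λ z → z ℚ.* x) (ι-* k (k ^ N))) (eq (ι k) (ι (k ^ N)) x) ⟩
    ι (k ^ N) ℚ.* (ι k ℚ.* series (grid k (suc N)) m)
      ≤⟨ *-monoˡ (ι≥0 (k ^ N)) (exp-step k N m) ⟩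
    ι (k ^ N) ℚ.* (ι (suc k) ℚ.* series (grid k N) m)
      ≡⟨ sym (eq (ι (suc k)) (ι (k ^ N)) _) ⟩
    ι (suc k) ℚ.* ι (k ^ N) ℚ.* series (grid k N) m
      ≡⟨ ℚ.*-assoc (ι (suc k)) (ι (k ^ N)) _ ⟩
    ι (suc k) ℚ.* (ι (k ^ N) ℚ.* series (grid k N) m)
      ≤⟨ *-monoˡ (ι≥0 (suc k)) (exp-grid k N m) ⟩
    ι (suc k) ℚ.* ι (suc k ^ N)
      ≡⟨ sym (ι-* (suc k) (suc k ^ N)) ⟩
    ι (suc k ^ suc N) ∎
    where
    x = series (grid k (suc N)) m
    eq : ∀ a b c → a ℚ.* b ℚ.* c ≡ b ℚ.* (a ℚ.* c)
    eq = solve 3 (λ a b c → a :* b :* c := b :* (a :* c)) refl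

  pow≥0 : ∀ {y} M → 0ℚ ℚ.≤ y → 0ℚ ℚ.≤ powℚ y M
  pow≥0 zero    y≥0 = 0≤1
  pow≥0 (suc M) y≥0 = *≥0 (pow≥0 M y≥0) y≥0

  pow-mono : ∀ {y z} M → 0ℚ ℚ.≤ y → y ℚ.≤ z → powℚ y M ℚ.≤ powℚ z M
  pow-mono zero    y≥0 y≤z = ℚ.≤-refl
  pow-mono (suc M) y≥0 y≤z = *-mono (pow≥0 M y≥0) (ℚ.≤-trans y≥0 y≤z) (pow-mono M y≥0 y≤z) y≤z

  pow>0 : ∀ {y} M → 0ℚ ℚ.< y → 0ℚ ℚ.< powℚ y M
  pow>0     zero    y>0 = ℚ.positive⁻¹ 1ℚ
  pow>0 {y} (suc M) y>0 = ℚ.positive⁻¹ _ {{ℚ.pos*pos⇒pos (powℚ y M) {{ℚ.positive (pow>0 M y>0)}} y {{ℚ.positive y>0}}}}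

  pow-cancel-≤ : ∀ {y z} M .{{_ : NonZero M}} → 0ℚ ℚ.≤ z → powℚ y M ℚ.≤ powℚ z M → y ℚ.≤ z
  pow-cancel-≤ {y} {z} (suc M) z≥0 h with y ℚ.≤? z
  ... | yes y≤z = y≤z
  ... | no  y≰z = ⊥-elim (ℚ.<-irrefl refl (ℚ.<-≤-trans power< h))
    where
    z<y = ℚ.≰⇒> y≰z
    power< : powℚ z (suc M) ℚ.< powℚ y (suc M)
    power< = begin-strict
      powℚ z M ℚ.* z  ≤⟨ *-monoʳ z≥0 (pow-mono M z≥0 (ℚ.<⇒≤ z<y)) ⟩
      powℚ y M ℚ.* z  <⟨ ℚ.*-monoʳ-<-pos (powℚ y M) {{ℚ.positive (pow>0 M (ℚ.≤-<-trans z≥0 z<y))}} z<y ⟩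
      powℚ y M ℚ.* y  ∎

  pow-grid : ∀ k N M → powℚ (grid k N) M ℚ.* ι (suc k ^ M) ≡ ι (N ^ M)
  pow-grid k N zero    = ℚ.*-identityˡ (ι 1)
  pow-grid k N (suc M) = begin-equality
    powℚ (grid k N) M ℚ.* (ι N ℚ.* recip k) ℚ.* ι (suc k ^ suc M)
      ≡⟨ cong (powℚ (grid k N) M ℚ.* (ι N ℚ.* recip k) ℚ.*_) (ι-* (suc k) (suc k ^ M)) ⟩
    powℚ (grid k N) M ℚ.* (ι N ℚ.* recip k) ℚ.* (ι (suc k) ℚ.* ι (suc k ^ M))
      ≡⟨ eq (powℚ (grid k N) M) (ι N) (recip k) (ι (suc k)) (ι (suc k ^ M)) ⟩
    ι N ℚ.* (powℚ (grid k N) M ℚ.* ι (suc k ^ M)) ℚ.* (ι (suc k) ℚ.* recip k)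
      ≡⟨ cong₂ (λ x y → ι N ℚ.* x ℚ.* y) (pow-grid k N M) (suc*recip k) ⟩
    ι N ℚ.* ι (N ^ M) ℚ.* 1ℚ
      ≡⟨ ℚ.*-identityʳ _ ⟩
    ι N ℚ.* ι (N ^ M)
      ≡⟨ sym (ι-* N (N ^ M)) ⟩
    ι (N ^ suc M) ∎
    where
    eq : ∀ p n g s t → p ℚ.* (n ℚ.* g) ℚ.* (s ℚ.* t) ≡ n ℚ.* (p ℚ.* t) ℚ.* (s ℚ.* g)
    eq = solve 5 (λ p n g s t → p :* (n :* g) :* (s :* t) := n :* (p :* t) :* (s :* g)) refl

  -- The hypotheses say that exp(N/(k+1)) ≤ ((k+1)/k)^N ≤ Δ and Δ^(q/M) ≤ N/(k+1).
  boundOK : ∀ k N M Δ q .{{_ : NonZero k}} .{{_ : NonZero M}} →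
    suc k ^ N ≤ Δ * k ^ N → Δ ^ q * suc k ^ M ≤ N ^ M → BoundOK M Δ q
  boundOK k N M Δ q small large y y≥0 yM m = subst₂ ℚ._≤_ (sym (expPartial≡series y m)) (ι≡fromℕ Δ) (cancelʳ (ι>0 (k ^ N) {{ℕ.m^n≢0 k N}}) (begin
    series y m ℚ.* ι (k ^ N)           ≤⟨ *-monoʳ (ι≥0 (k ^ N)) (series-mono m y≥0 y≤) ⟩
    series (grid k N) m ℚ.* ι (k ^ N)  ≡⟨ ℚ.*-comm (series (grid k N) m) (ι (k ^ N)) ⟩
    ι (k ^ N) ℚ.* series (grid k N) m  ≤⟨ exp-grid k N m ⟩
    ι (suc k ^ N)                      ≤⟨ ι-mono small ⟩
    ι (Δ * k ^ N)                      ≡⟨ ι-* Δ (k ^ N) ⟩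
    ι Δ ℚ.* ι (k ^ N)                  ∎))
    where
    y≤ : y ℚ.≤ grid k N
    y≤ = pow-cancel-≤ M (grid≥0 k N) (ℚ.≤-trans (subst (powℚ y M ℚ.≤_) (sym (ι≡fromℕ (Δ ^ q))) yM) (cancelʳ (ι>0 (suc k ^ M) {{ℕ.m^n≢0 (suc k) M}}) (begin
      ι (Δ ^ q) ℚ.* ι (suc k ^ M)          ≡⟨ sym (ι-* (Δ ^ q) (suc k ^ M)) ⟩
      ι (Δ ^ q * suc k ^ M)                ≤⟨ ι-mono large ⟩
      ι (N ^ M)                            ≡⟨ sym (pow-grid k N M) ⟩
      powℚ (grid k N) M ℚ.* ι (suc k ^ M)  ∎)))

-- Numerical estimates

m<[1+m/n]*n : ∀ m n .{{_ : NonZero n}} → m < suc (m / n) * n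
m<[1+m/n]*n m n = subst (_< suc (m / n) * n) (sym (m≡m%n+[m/n]*n m n)) (+-monoˡ-< (m / n * n) (m%n<n m n))

m<2^m : ∀ m → m < 2 ^ m
m<2^m zero    = s≤s z≤n
m<2^m (suc m) = begin-strict
  suc m          <⟨ s≤s (m<2^m m) ⟩
  1 + 2 ^ m      ≤⟨ +-monoˡ-≤ (2 ^ m) (m^n>0 2 m) ⟩
  2 ^ m + 2 ^ m  ≡⟨ cong (2 ^ m +_) (sym (+-identityʳ (2 ^ m))) ⟩
  2 ^ suc m      ∎
  where open ≤-Reasoning

*-distribʳ-^ : ∀ a b n → (a * b) ^ n ≡ a ^ n * b ^ n
*-distribʳ-^ a b zero    = refl
*-distribʳ-^ a b (suc n) rewrite *-distribʳ-^ a b n = eq a b (a ^ n) (b ^ n)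
  where
  eq : ∀ a b x y → a * b * (x * y) ≡ a * x * (b * y)
  eq = solve-∀

-- This is (1 + 1/N)^n ≤ N / (N - n) with `k` for N - n; each factor uses (N + 1) k ≤ N (k + 1),
-- valid for k ≤ N.
bernoulli : ∀ {N} n k → n + k ≡ N → suc N ^ n * k ≤ N ^ n * N
bernoulli zero    k refl = ≤-refl
bernoulli {N} (suc n) k eq = begin
  suc N * suc N ^ n * k    ≡⟨ eq₁ N (suc N ^ n) k ⟩
  suc N ^ n * (k + N * k)  ≤⟨ *-monoʳ-≤ (suc N ^ n) (+-monoˡ-≤ (N * k) (≤-trans (m≤n+m k (suc n)) (≤-reflexive eq))) ⟩
  suc N ^ n * (N + N * k)  ≡⟨ eq₂ N (suc N ^ n) k ⟩
  N * (suc N ^ n * suc k)  ≤⟨ *-monoʳ-≤ N (bernoulli n (suc k) (trans (+-suc n k) eq)) ⟩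
  N * (N ^ n * N)          ≡⟨ sym (*-assoc N (N ^ n) N) ⟩
  N ^ suc n * N            ∎
  where
  open ≤-Reasoning
  eq₁ : ∀ N x k → suc N * x * k ≡ x * (k + N * k)
  eq₁ = solve-∀
  eq₂ : ∀ N x k → x * (N + N * k) ≡ N * (x * suc k)
  eq₂ = solve-∀

suc-^≤2* : ∀ N n .{{_ : NonZero N}} → 2 * n ≤ N → suc N ^ n ≤ 2 * N ^ n
suc-^≤2* N n h = *-cancelʳ-≤ _ _ N (begin
  suc N ^ n * N        ≤⟨ *-monoʳ-≤ (suc N ^ n) N≤2k ⟩
  suc N ^ n * (2 * k)  ≡⟨ eq₁ (suc N ^ n) k ⟩
  2 * (suc N ^ n * k)  ≤⟨ *-monoʳ-≤ 2 (bernoulli n k (m+[n∸m]≡n n≤N)) ⟩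
  2 * (N ^ n * N)      ≡⟨ sym (*-assoc 2 (N ^ n) N) ⟩
  2 * N ^ n * N        ∎)
  where
  open ≤-Reasoning
  k = N ∸ n
  n≤N : n ≤ N
  n≤N = ≤-trans (m≤n*m n 2) h
  eq₁ : ∀ x k → x * (2 * k) ≡ 2 * (x * k)
  eq₁ = solve-∀
  eq₂ : ∀ n k → n + k + (n + k) ≡ 2 * n + 2 * k
  eq₂ = solve-∀
  N≤2k : N ≤ 2 * k
  N≤2k = +-cancelˡ-≤ N N (2 * k) (begin
    N + N            ≡⟨ cong (λ x → x + x) (sym (m+[n∸m]≡n n≤N)) ⟩
    n + k + (n + k)  ≡⟨ eq₂ n k ⟩
    2 * n + 2 * k    ≤⟨ +-monoˡ-≤ (2 * k) h ⟩
    N + 2 * k        ∎)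

-- From j to j + 1 the right side doubles, while the left side at most doubles by `suc-^≤2*`.
growth-from : ∀ p n → 2 * n ≤ p → 2 * suc p ^ n ≤ 2 ^ p → ∀ j → p ≤ j → 2 * suc j ^ n ≤ 2 ^ j
growth-from p n 2n≤p base j p≤j = subst (λ j → 2 * suc j ^ n ≤ 2 ^ j) (m∸n+n≡m p≤j) (go (j ∸ p))
  where
  open ≤-Reasoning
  go : ∀ i → 2 * suc (i + p) ^ n ≤ 2 ^ (i + p)
  go zero    = base
  go (suc i) = begin
    2 * suc (suc (i + p)) ^ n  ≤⟨ *-monoʳ-≤ 2 (suc-^≤2* (suc (i + p)) n (≤-trans 2n≤p (≤-trans (m≤n+m p i) (n≤1+n _)))) ⟩
    2 * (2 * suc (i + p) ^ n)  ≤⟨ *-monoʳ-≤ 2 (go i) ⟩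
    2 ^ (suc i + p)            ∎

-- Here d = ⌊log₂ Δ⌋, 2^E ≤ d/2 < 2^(E+1), and sparse says that the greedy bound Δ + 1 does not
-- suffice. Fibres with more than 2^p ≈ Δ^(1/4) independent sets have independent sets of average
-- size at least K, and ℓ ≈ √Δ is the growth factor.
module Parameters (r′ d E Δ : ℕ) .{{_ : NonZero E}}
  (4≤r : 4 ≤ suc r′) (3≤E : 3 ≤ E)
  (Δ-lower : 2 ^ d ≤ Δ) (Δ-upper : Δ < 2 ^ suc d) (d-upper : d < 2 ^ (2 + E))
  (sparse : E * (200 * suc r′ * Δ) < suc d * suc Δ) where
  open ≤-Reasoning

  private
    r D K q p h ℓ : ℕ
    r = suc r′
    -- So `K` is about log Δ / (32 r log log Δ). The 32 serves `growth-base`: its exponent `e` is at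
    -- most 2 r K, and 16 (2 r K) E = K D ≤ d.
    D = 32 * r * E
    instance
      D≢0 : NonZero D
      D≢0 = m*n≢0 (32 * r) E
    K = d / D
    q = E * (200 * r * Δ) / suc d
    p = d / 4
    h = d / 2
    -- The successor ensures ℓ² ≥ 2^(d + 1) for either parity of `d`.
    ℓ = 2 ^ suc h

    instance
      Δ≢0 : NonZero Δ
      Δ≢0 = ℕ.>-nonZero (≤-trans (m^n>0 2 d) Δ-lower)

  -- `sparse` together with Δ + 1 ≤ 2Δ: where the greedy bound fails, log Δ dominates r log log Δ.
  -- This is the source of the slack below.
  100rE≤d : 100 * r * E ≤ d
  100rE≤d = ≤-pred (*-cancelʳ-< (2 * Δ) (100 * r * E) (suc d) (begin-strict
    100 * r * E * (2 * Δ)  ≡⟨ eq r E Δ ⟩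
    E * (200 * r * Δ)      <⟨ sparse ⟩
    suc d * suc Δ          ≤⟨ *-monoʳ-≤ (suc d) (+-monoˡ-≤ Δ (ℕ.>-nonZero⁻¹ Δ)) ⟩
    suc d * (Δ + Δ)        ≡⟨ cong (λ x → suc d * (Δ + x)) (sym (+-identityʳ Δ)) ⟩
    suc d * (2 * Δ)        ∎))
    where
    eq : ∀ r E Δ → 100 * r * E * (2 * Δ) ≡ E * (200 * r * Δ)
    eq = solve-∀

  400E≤d : 400 * E ≤ d
  400E≤d = ≤-trans (*-monoˡ-≤ E (*-monoʳ-≤ 100 4≤r)) 100rE≤d

  1200≤d : 1200 ≤ d
  1200≤d = ≤-trans (*-monoʳ-≤ 400 3≤E) 400E≤d

  KD≤d : K * D ≤ d
  KD≤d = m/n*n≤m d D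

  d<[1+K]D : d < suc K * D
  d<[1+K]D = m<[1+m/n]*n d D

  1≤K : 1 ≤ K
  1≤K = ≤-pred (*-cancelʳ-< D 1 (suc K) (begin-strict
    1 * D        ≡⟨ eq r E ⟩
    32 * r * E   ≤⟨ *-monoˡ-≤ E (*-monoˡ-≤ r (toWitness {a? = 32 ≤? 100} _)) ⟩
    100 * r * E  ≤⟨ 100rE≤d ⟩
    d            <⟨ d<[1+K]D ⟩
    suc K * D    ∎))
    where
    eq : ∀ r E → 1 * (32 * r * E) ≡ 32 * r * E
    eq = solve-∀

  K≤d : K ≤ d
  K≤d = ≤-trans (m≤m*n K D) KD≤d

  d≤Δ : d ≤ Δ
  d≤Δ = ≤-trans (<⇒≤ (m<2^m d)) Δ-lower

  -- Both quotients are rounded down. For `K` this costs a factor 2, by `suc K` ≤ 2K; for `q` it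
  -- costs a summand K ≤ Δ, so 3Δ is aimed at. Hence 2 * 32 * 3 = 192 of the constant 200 is used.
  2Δ≤qK : 2 * Δ ≤ q * K
  2Δ≤qK = +-cancelˡ-≤ Δ _ _ (begin
    Δ + 2 * Δ  ≡⟨⟩
    3 * Δ      ≤⟨ 3Δ≤ ⟩
    K + q * K  ≤⟨ +-monoˡ-≤ (q * K) (≤-trans K≤d d≤Δ) ⟩
    Δ + q * K  ∎)
    where
    rE = r * E
    instance
      rE≢0 : NonZero rE
      rE≢0 = m*n≢0 r E
    eq₁ : ∀ Δ r E → 64 * (3 * Δ) * (r * E) + 8 * Δ * (r * E) ≡ E * (200 * r * Δ)
    eq₁ = solve-∀
    eq₂ : ∀ q K r E → suc q * ((K + K) * (32 * r * E)) ≡ 64 * (suc q * K) * (r * E)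
    eq₂ = solve-∀
    3Δ≤ : 3 * Δ ≤ suc q * K
    3Δ≤ = *-cancelˡ-≤ 64 (*-cancelʳ-≤ _ _ rE (begin
      64 * (3 * Δ) * rE               ≤⟨ m≤m+n _ (8 * Δ * rE) ⟩
      64 * (3 * Δ) * rE + 8 * Δ * rE  ≡⟨ eq₁ Δ r E ⟩
      E * (200 * r * Δ)               ≤⟨ <⇒≤ (m<[1+m/n]*n (E * (200 * r * Δ)) (suc d)) ⟩
      suc q * suc d                   ≤⟨ *-monoʳ-≤ (suc q) d<[1+K]D ⟩
      suc q * (suc K * D)             ≤⟨ *-monoʳ-≤ (suc q) (*-monoˡ-≤ D (+-monoˡ-≤ K 1≤K)) ⟩
      suc q * ((K + K) * D)           ≡⟨ eq₂ q K r E ⟩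
      64 * (suc q * K) * rE           ∎))

  d<4[1+p] : d < 4 * suc p
  d<4[1+p] = subst (d <_) (*-comm (suc p) 4) (m<[1+m/n]*n d 4)

  2≤p : 2 ≤ p
  2≤p = ≤-pred (*-cancelˡ-< 4 2 (suc p) (≤-<-trans (≤-trans (toWitness {a? = 8 ≤? 1200} _) 1200≤d) d<4[1+p]))

  e : ℕ
  e = r′ * (2 * K)

  16nE≤d : 16 * (e * E) ≤ d
  16nE≤d = begin
    16 * (r′ * (2 * K) * E)  ≤⟨ *-monoʳ-≤ 16 (*-monoˡ-≤ E (*-monoˡ-≤ (2 * K) (n≤1+n r′))) ⟩
    16 * (r * (2 * K) * E)   ≡⟨ eq r K E ⟩
    K * D                    ≤⟨ KD≤d ⟩
    d                        ∎
    where
    eq : ∀ r K E → 16 * (r * (2 * K) * E) ≡ K * (32 * r * E)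
    eq = solve-∀

  4nE≤p : 4 * (e * E) ≤ p
  4nE≤p = ≤-pred (*-cancelˡ-< 4 (4 * (e * E)) (suc p) (begin-strict
    4 * (4 * (e * E))  ≡⟨ sym (*-assoc 4 4 (e * E)) ⟩
    16 * (e * E)       ≤⟨ 16nE≤d ⟩
    d                  <⟨ d<4[1+p] ⟩
    4 * suc p          ∎))

  2n≤p : 2 * e ≤ p
  2n≤p = ≤-trans (*-mono-≤ (toWitness {a? = 2 ≤? 4} _) (m≤m*n e E)) 4nE≤p

  -- Since p + 1 ≤ d < 2^(E + 2), the left side has logarithm at most 1 + (E + 2) e ≤ 1 + 2 E e ≤ 1
  -- + p/2 ≤ p.
  growth-base : 2 * suc p ^ e ≤ 2 ^ p
  growth-base = begin
    2 * suc p ^ e          ≤⟨ *-monoʳ-≤ 2 (^-monoˡ-≤ e (≤-trans p<d (<⇒≤ d-upper))) ⟩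
    2 * (2 ^ (2 + E)) ^ e  ≡⟨ cong (2 *_) (^-*-assoc 2 (2 + E) e) ⟩
    2 ^ suc ((2 + E) * e)  ≤⟨ ^-monoʳ-≤ 2 exponent ⟩
    2 ^ p                  ∎
    where
    p<d : p < d
    p<d = begin-strict
      p                <⟨ m<m+n p (≤-trans (s≤s z≤n) 2≤p) ⟩
      p + p            ≤⟨ m≤m+n (p + p) (p + p) ⟩
      p + p + (p + p)  ≡⟨ eq p ⟩
      p * 4            ≤⟨ m/n*n≤m d 4 ⟩
      d                ∎
      where
      eq : ∀ p → p + p + (p + p) ≡ p * 4
      eq = solve-∀
    exponent : suc ((2 + E) * e) ≤ p
    exponent = *-cancelˡ-≤ 2 (begin
      2 * suc ((2 + E) * e)  ≤⟨ *-monoʳ-≤ 2 (s≤s (*-monoˡ-≤ e (+-monoˡ-≤ E (≤-trans (n≤1+n 2) 3≤E)))) ⟩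
      2 * suc ((E + E) * e)  ≡⟨ eq E e ⟩
      2 + 4 * (e * E)        ≤⟨ +-mono-≤ 2≤p 4nE≤p ⟩
      p + p                  ≡⟨ cong (p +_) (sym (+-identityʳ p)) ⟩
      2 * p                  ∎)
      where
      eq : ∀ E e → 2 * suc ((E + E) * e) ≡ 2 + 4 * (e * E)
      eq = solve-∀

  -- `p` and `h` take a quarter and a half of `d`; the last quarter pays for `E` and the constants,
  -- as d ≥ 400 E.
  exponents : p + 2 + suc h + (2 + E) ≤ suc d
  exponents = *-cancelˡ-≤ 4 (begin
    4 * (p + 2 + suc h + (2 + E))     ≡⟨ eq₁ p h E ⟩
    p * 4 + 2 * (h * 2) + 4 * E + 20  ≤⟨ +-monoˡ-≤ 20 (+-mono-≤ (+-mono-≤ (m/n*n≤m d 4) (*-monoʳ-≤ 2 (m/n*n≤m d 2))) ≤-refl) ⟩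
    d + 2 * d + 4 * E + 20            ≡⟨ eq₂ d E ⟩
    3 * d + (4 * E + 16 * 1) + 4      ≤⟨ +-monoˡ-≤ 4 (+-monoʳ-≤ (3 * d) small) ⟩
    3 * d + d + 4                     ≡⟨ eq₃ d ⟩
    4 * suc d                         ∎)
    where
    eq₁ : ∀ p h E → 4 * (p + 2 + suc h + (2 + E)) ≡ p * 4 + 2 * (h * 2) + 4 * E + 20
    eq₁ = solve-∀
    eq₂ : ∀ d E → d + 2 * d + 4 * E + 20 ≡ 3 * d + (4 * E + 16 * 1) + 4
    eq₂ = solve-∀
    eq₃ : ∀ d → 3 * d + d + 4 ≡ 4 * suc d
    eq₃ = solve-∀
    small : 4 * E + 16 * 1 ≤ d
    small = begin
      4 * E + 16 * 1  ≤⟨ +-monoʳ-≤ (4 * E) (*-monoʳ-≤ 16 (ℕ.>-nonZero⁻¹ E)) ⟩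
      4 * E + 16 * E  ≡⟨ sym (*-distribʳ-+ E 4 16) ⟩
      20 * E          ≤⟨ *-monoˡ-≤ E (toWitness {a? = 20 ≤? 400} _) ⟩
      400 * E         ≤⟨ 400E≤d ⟩
      d               ∎

  -- From q K ≥ 2Δ and K ≤ d < 2^(E + 2), `q` falls short of Δ by at most a factor of order log Δ,
  -- far above 2^p ℓ ≈ Δ^(3/4).
  q-lower : 2 ^ (p + 2 + suc h) ≤ q
  q-lower = *-cancelʳ-≤ _ _ (2 ^ (2 + E)) {{m^n≢0 2 (2 + E)}} (begin
    2 ^ (p + 2 + suc h) * 2 ^ (2 + E)  ≡⟨ sym (^-distribˡ-+-* 2 (p + 2 + suc h) (2 + E)) ⟩
    2 ^ (p + 2 + suc h + (2 + E))      ≤⟨ ^-monoʳ-≤ 2 exponents ⟩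
    2 * 2 ^ d                          ≤⟨ *-monoʳ-≤ 2 Δ-lower ⟩
    2 * Δ                              ≤⟨ 2Δ≤qK ⟩
    q * K                              ≤⟨ *-monoʳ-≤ q (≤-trans K≤d (<⇒≤ d-upper)) ⟩
    q * 2 ^ (2 + E)                    ∎)

  Δ≤ℓ² : Δ ≤ ℓ * ℓ
  Δ≤ℓ² = begin
    Δ                    ≤⟨ <⇒≤ Δ-upper ⟩
    2 ^ suc d            ≤⟨ ^-monoʳ-≤ 2 (subst (suc d ≤_) (eq h) (m<[1+m/n]*n d 2)) ⟩
    2 ^ (suc h + suc h)  ≡⟨ ^-distribˡ-+-* 2 (suc h) (suc h) ⟩
    ℓ * ℓ                ∎
    where
    eq : ∀ h → suc h * 2 ≡ suc h + suc h
    eq = solve-∀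

  qℓ : 2 * 2 ^ p * (ℓ * ℓ + Δ) ≤ q * ℓ
  qℓ = begin
    2 * 2 ^ p * (ℓ * ℓ + Δ)      ≤⟨ *-monoʳ-≤ (2 * 2 ^ p) (+-monoʳ-≤ (ℓ * ℓ) Δ≤ℓ²) ⟩
    2 * 2 ^ p * (ℓ * ℓ + ℓ * ℓ)  ≡⟨ eq (2 ^ p) ℓ ⟩
    2 ^ p * 4 * ℓ * ℓ            ≡⟨ cong (_* ℓ) (trans (cong (_* ℓ) (sym (^-distribˡ-+-* 2 p 2))) (sym (^-distribˡ-+-* 2 (p + 2) (suc h)))) ⟩
    2 ^ (p + 2 + suc h) * ℓ      ≤⟨ *-monoˡ-≤ ℓ q-lower ⟩
    q * ℓ                        ∎
    where
    eq : ∀ x ℓ → 2 * x * (ℓ * ℓ + ℓ * ℓ) ≡ x * 4 * ℓ * ℓ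
    eq = solve-∀

  choosable : ∀ G → ¬ ContainsK G r → (∀ v → degree G v ≤ Δ) → Choosable G q
  choosable G free deg = cliqueFree-choosable G {q} {Δ} {ℓ} {K} {p} {r′}
    {{ℕ.>-nonZero 1≤K}} {{m^n≢0 2 (suc h)}}
    free deg (growth-from p e 2n≤p growth-base) 2Δ≤qK qℓ

-- Verifying the bound and choosing between the regimes

large-boundOK : ∀ {d E Δ q} M .{{_ : NonZero M}} → 2 ^ d ≤ Δ → Δ ≤ 2 ^ suc d → 2 ^ suc E ≤ d →
  suc d * q ≤ E * M → BoundOK M Δ q
-- Mesh 1/2 suffices: exp(d/2) ≤ 2^d ≤ Δ, while Δ^(q/M) ≤ 2^((d + 1) q/M) ≤ 2^E ≤ d/2.
large-boundOK {d} {E} {Δ} {q} M lower upper d-lower h = ExponentialBounds.boundOK 1 d M Δ q small large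
  where
  open ≤-Reasoning
  small : 2 ^ d ≤ Δ * 1 ^ d
  small = ≤-trans lower (≤-reflexive (sym (trans (cong (Δ *_) (^-zeroˡ d)) (*-identityʳ Δ))))
  large : Δ ^ q * 2 ^ M ≤ d ^ M
  large = begin
    Δ ^ q * 2 ^ M            ≤⟨ *-monoˡ-≤ (2 ^ M) (^-monoˡ-≤ q upper) ⟩
    (2 ^ suc d) ^ q * 2 ^ M  ≡⟨ cong (_* 2 ^ M) (^-*-assoc 2 (suc d) q) ⟩
    2 ^ (suc d * q) * 2 ^ M  ≤⟨ *-monoˡ-≤ (2 ^ M) (^-monoʳ-≤ 2 h) ⟩
    2 ^ (E * M) * 2 ^ M      ≡⟨ sym (^-distribˡ-+-* 2 (E * M) M) ⟩
    2 ^ (E * M + M)          ≡⟨ cong (2 ^_) (+-comm (E * M) M) ⟩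
    2 ^ (suc E * M)          ≡⟨ sym (^-*-assoc 2 (suc E) M) ⟩
    (2 ^ suc E) ^ M          ≤⟨ ^-monoˡ-≤ M d-lower ⟩
    d ^ M                    ∎

-- Twelve factors 17/16 exceed 2, and `M` provides twelve for each of the `e` factors 2.
2^*16^≤17^ : ∀ e M → 12 * e ≤ M → 2 ^ e * 16 ^ M ≤ 17 ^ M
2^*16^≤17^ e M h = begin
  2 ^ e * 16 ^ M                    ≡⟨ cong (2 ^ e *_) (split 16) ⟩
  2 ^ e * ((16 ^ 12) ^ e * 16 ^ f)  ≡⟨ sym (*-assoc (2 ^ e) _ _) ⟩
  2 ^ e * (16 ^ 12) ^ e * 16 ^ f    ≡⟨ cong (_* 16 ^ f) (sym (*-distribʳ-^ 2 (16 ^ 12) e)) ⟩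
  (2 * 16 ^ 12) ^ e * 16 ^ f        ≤⟨ *-mono-≤ (^-monoˡ-≤ e (toWitness {a? = 2 * 16 ^ 12 ≤? 17 ^ 12} _)) (^-monoˡ-≤ f (n≤1+n 16)) ⟩
  (17 ^ 12) ^ e * 17 ^ f            ≡⟨ sym (split 17) ⟩
  17 ^ M                            ∎
  where
  open ≤-Reasoning
  f = M ∸ 12 * e
  split : ∀ b → b ^ M ≡ (b ^ 12) ^ e * b ^ f
  split b = trans (cong (b ^_) (sym (m+[n∸m]≡n h))) (trans (^-distribˡ-+-* b (12 * e) f)
    (cong (_* b ^ f) (sym (^-*-assoc b 12 e))))

-- exp(17/16) ≤ (16/15)^17 ≤ 3.
small-boundOK : ∀ {Δ} M .{{_ : NonZero M}} → 3 ≤ Δ → Δ ≤ 2 ^ 16 → 800 * Δ ≤ M → BoundOK M Δ (suc Δ)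
small-boundOK {Δ} M 3≤Δ upper h = ExponentialBounds.boundOK 15 17 M Δ (suc Δ) small large
  where
  open ≤-Reasoning
  small : 16 ^ 17 ≤ Δ * 15 ^ 17
  small = ≤-trans (toWitness {a? = 16 ^ 17 ≤? 3 * 15 ^ 17} _) (*-monoˡ-≤ (15 ^ 17) 3≤Δ)
  -- Δ ≤ 2^16 gives Δ^((Δ + 1)/M) ≤ 2^(16 (Δ + 1)/M), and M ≥ 800Δ keeps this exponent below 1/12 <
  -- log₂(17/16).
  large : Δ ^ suc Δ * 16 ^ M ≤ 17 ^ M
  large = begin
    Δ ^ suc Δ * 16 ^ M         ≤⟨ *-monoˡ-≤ (16 ^ M) (^-monoˡ-≤ (suc Δ) upper) ⟩
    (2 ^ 16) ^ suc Δ * 16 ^ M  ≡⟨ cong (_* 16 ^ M) (^-*-assoc 2 16 (suc Δ)) ⟩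
    2 ^ (16 * suc Δ) * 16 ^ M  ≤⟨ 2^*16^≤17^ (16 * suc Δ) M exponent ⟩
    17 ^ M                     ∎
    where
    eq : ∀ Δ → 12 * (16 * (Δ + Δ)) ≡ 384 * Δ
    eq = solve-∀
    exponent : 12 * (16 * suc Δ) ≤ M
    exponent = begin
      12 * (16 * suc Δ)    ≤⟨ *-monoʳ-≤ 12 (*-monoʳ-≤ 16 (+-monoˡ-≤ Δ (≤-trans (s≤s z≤n) 3≤Δ))) ⟩
      12 * (16 * (Δ + Δ))  ≡⟨ eq Δ ⟩
      384 * Δ              ≤⟨ *-monoˡ-≤ Δ (toWitness {a? = 384 ≤? 800} _) ⟩
      800 * Δ              ≤⟨ h ⟩
      M                    ∎

theorem2 : (r : ℕ) → 4 ≤ r → (G : Graph) → ¬ ContainsK G r →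
    (Δ : ℕ) → MaxDegree G Δ → 3 ≤ Δ → ListChromaticBound G r Δ
theorem2 (suc r′) 4≤r G free Δ (deg , _) 3≤Δ = conclude (log₂-bounds (≤-trans (s≤s z≤n) 3≤Δ))
  where
  r = suc r′
  M = 200 * r * Δ
  instance
    M≢0 : NonZero M
    M≢0 = m*n≢0 (200 * r) Δ {{_}} {{ℕ.>-nonZero (≤-trans (s≤s z≤n) 3≤Δ)}}

  rich : ∀ d E → 3 ≤ E → 2 ^ d ≤ Δ → Δ < 2 ^ suc d → 2 ^ suc E ≤ d → d < 2 ^ (2 + E) → ListChromaticBound G r Δ
  rich d E 3≤E lower upper d-lower d-upper with suc d * suc Δ ≤? E * M
  ... | yes easy = suc Δ , large-boundOK {E = E} M lower (<⇒≤ upper) d-lower easy , greedy-choosable G deg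
  -- The largest number of colours that `large-boundOK` admits; `hard` becomes the hypothesis
  -- `sparse`.
  ... | no  hard = E * M / suc d ,
    large-boundOK {E = E} M lower (<⇒≤ upper) d-lower (subst (_≤ E * M) (*-comm (E * M / suc d) (suc d)) (m/n*n≤m (E * M) (suc d))) ,
    Parameters.choosable r′ d E Δ {{ℕ.>-nonZero (≤-trans (s≤s z≤n) 3≤E)}} 4≤r 3≤E lower upper d-upper (≰⇒> hard) G free deg

  conclude : (∃ λ d → 2 ^ d ≤ Δ × Δ < 2 ^ suc d) → ListChromaticBound G r Δ
  conclude (d , lower , upper) with 16 ≤? d
  -- Past this threshold log₂ d ≥ 4, which is where `3 ≤ E` comes from. Below it, r ≥ 4 gives 200 r
  -- Δ ≥ 800Δ, enough for the greedy bound.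
  ... | no d<16 = suc Δ ,
    small-boundOK M 3≤Δ (≤-trans (<⇒≤ upper) (^-monoʳ-≤ 2 (≰⇒> d<16))) (*-monoˡ-≤ Δ (*-monoʳ-≤ 200 4≤r)) ,
    greedy-choosable G deg
  ... | yes 16≤d with log₂-bounds (≤-trans (s≤s z≤n) 16≤d)
  ...   | zero  , _ , d<2 = ⊥-elim (<⇒≱ d<2 (≤-trans (toWitness {a? = 2 ≤? 16} _) 16≤d))
  -- `E` is one less than ⌊log₂ d⌋, so that 2^E ≤ d/2 as the mesh 1/2 requires.
  ...   | suc E , d-lower , d-upper = rich d E 3≤E lower upper d-lower d-upper
    where
    3≤E : 3 ≤ E
    3≤E with 3 ≤? E
    ... | yes p = p
    ... | no  p = ⊥-elim (<⇒≱ (<-≤-trans d-upper (^-monoʳ-≤ 2 (s≤s (≰⇒> p)))) 16≤d)
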